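{- Let $0<s<2m$ with $s\neq m$, let $t$ be a legitimate quadruple, and let $l\in L^*\setminus(L^*)^{\sigma-1}$ (so $l\neq 0$). Let $S$ be a semifield isotopic to $B(2,m,s,l,t)$. Then the middle nucleus of $S$ is a quadratic extension of the center of $S$.
   Context: A (finite) presemifield is a finite additive abelian group with a multiplication that is distributive on both sides over addition and has no zero divisors; it is a semifield if it also has a multiplicative identity. Two presemifields $(F,+,*)$ and $(F,+,\circ)$ are isotopic if there are additive bijections $\alpha_1,\alpha_2,\beta$ with $\beta(\alpha_1(x)*\alpha_2(y))=x\circ y$ for all $x,y$. In a semifield, an element $u$ belongs to the left, middle, right nucleus if, respectively, $u*(y*w)=(u*y)*w$, $y*(u*w)=(y*u)*w$, $y*(w*u)=(y*w)*u$ for all $y,w$; the center consists of the elements in all three nuclei that commute with every element. Let $m\ge 1$, $L=GF(2^m)$, $\sigma=2^s$, $(L^*)^{\sigma-1}=\{u^{\sigma-1}:u\in L^*\}$. A quadruple $t=[p_1,p_2,p_3,p_4]\in L^4$ is legitimate if $p_1\neq0$ and $p_1X^{\sigma+1}+p_2X^{\sigma}+p_3X+p_4$ has no root in $L$. $B(2,m,s,l,t)$ is the presemifield on $L\times L$ with multiplication $$(a,b)\circ(c,d)=(p_1ac^{\sigma}+lp_1a^{\sigma}c+p_2bc^{\sigma}+lp_2a^{\sigma}d+p_3ad^{\sigma}+lp_3b^{\sigma}c+p_4bd^{\sigma}+lp_4b^{\sigma}d,\ ad+bc).$$ -}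

module Defs where

open import Algebra.Bundles using (AbelianGroup; CommutativeRing; NonAssociativeRing)
open import Algebra.Construct.DirectProduct using (abelianGroup)
open import Algebra.Core using (Op₂)
open import Algebra.Morphism.Structures using (module GroupMorphisms)
open import Data.Fin.Base using (Fin)
open import Data.Nat.Base as ℕ using (ℕ)
open import Data.Product.Base using (_×_; _,_; ∃; ∃-syntax; ∃₂)
open import Data.Sum.Base using (_⊎_)
open import Function.Bundles using (Inverse)
open import Level using (Level; _⊔_)
open import Relation.Binary.Bundles using (Setoid)
open import Relation.Binary.Definitions using (_Respects_)
open import Relation.Binary.PropositionalEquality using () renaming (setoid to ≡-setoid)
open import Relation.Nullary.Negation.Core using (¬_)
open import Relation.Unary using (Pred; _∈_; _⊆_)

private
  variable
    a b c ℓ ℓ₁ ℓ₂ k e : Level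

HasCardinality : Setoid c ℓ → ℕ → Set (c ⊔ ℓ)
HasCardinality A n = Inverse A (≡-setoid (Fin n))

IsFinite : Setoid c ℓ → Set (c ⊔ ℓ)
IsFinite A = ∃[ n ] HasCardinality A n

record IsField (R : CommutativeRing c ℓ) : Set (c ⊔ ℓ) where
  open CommutativeRing R
  field
    1≉0     : ¬ 1# ≈ 0#
    inverse : ∀ x → ¬ x ≈ 0# → ∃[ y ] x * y ≈ 1#

-- A field with q elements; it is unique up to isomorphism, so a statement
-- about GF(q) quantifies over all such fields.
record IsGF (q : ℕ) (R : CommutativeRing c ℓ) : Set (c ⊔ ℓ) where
  open CommutativeRing R using (setoid)
  field
    isField     : IsField R
    cardinality : HasCardinality setoid q

-- NonAssociativeRing already provides the abelian group, both distributive
-- laws and the two-sided identity.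
record IsSemifield (S : NonAssociativeRing c ℓ) : Set (c ⊔ ℓ) where
  open NonAssociativeRing S
  field
    finite         : IsFinite setoid
    noZeroDivisors : ∀ x y → x * y ≈ 0# → x ≈ 0# ⊎ y ≈ 0#

-- Isotopy only involves the additive groups and the multiplications, so it is
-- stated without bundling the presemifield axioms.
module _ (F : AbelianGroup a ℓ₁) (_*_ : Op₂ (AbelianGroup.Carrier F))
         (G : AbelianGroup b ℓ₂) (_∘_ : Op₂ (AbelianGroup.Carrier G)) where

  private
    module F = AbelianGroup F
    module G = AbelianGroup G
    module G→F = GroupMorphisms G.rawGroup F.rawGroup
    module F→G = GroupMorphisms F.rawGroup G.rawGroup

  record Isotopic : Set (a ⊔ b ⊔ ℓ₁ ⊔ ℓ₂) where
    field
      α₁ α₂    : G.Carrier → F.Carrier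
      β        : F.Carrier → G.Carrier
      α₁-iso   : G→F.IsGroupIsomorphism α₁
      α₂-iso   : G→F.IsGroupIsomorphism α₂
      β-iso    : F→G.IsGroupIsomorphism β
      isotopic : ∀ x y → β (α₁ x * α₂ y) G.≈ (x ∘ y)

module _ (S : NonAssociativeRing c ℓ) where
  open NonAssociativeRing S

  LeftNucleus : Pred Carrier (c ⊔ ℓ)
  LeftNucleus u = ∀ y w → u * (y * w) ≈ (u * y) * w

  MiddleNucleus : Pred Carrier (c ⊔ ℓ)
  MiddleNucleus u = ∀ y w → y * (u * w) ≈ (y * u) * w

  RightNucleus : Pred Carrier (c ⊔ ℓ)
  RightNucleus u = ∀ y w → y * (w * u) ≈ (y * w) * u

  Center : Pred Carrier (c ⊔ ℓ)
  Center u = LeftNucleus u × MiddleNucleus u × RightNucleus u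
           × (∀ y → u * y ≈ y * u)

  -- The subset K is a field under the operations of S.
  record IsSubfield (K : Pred Carrier k) : Set (c ⊔ ℓ ⊔ k) where
    field
      resp-≈   : K Respects _≈_
      0-closed : 0# ∈ K
      1-closed : 1# ∈ K
      +-closed : ∀ {x y} → x ∈ K → y ∈ K → x + y ∈ K
      neg-closed : ∀ {x} → x ∈ K → - x ∈ K
      *-closed : ∀ {x y} → x ∈ K → y ∈ K → x * y ∈ K
      *-assoc  : ∀ {x y z} → x ∈ K → y ∈ K → z ∈ K → (x * y) * z ≈ x * (y * z)
      *-comm   : ∀ {x y} → x ∈ K → y ∈ K → x * y ≈ y * x
      1≉0      : ¬ 1# ≈ 0#
      inverse  : ∀ {x} → x ∈ K → ¬ x ≈ 0# → ∃[ y ] y ∈ K × x * y ≈ 1#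

  -- e₁ , e₂ form a basis of E as a K-vector space.
  record IsBasis₂ (K : Pred Carrier k) (E : Pred Carrier e) (e₁ e₂ : Carrier)
                  : Set (c ⊔ ℓ ⊔ k ⊔ e) where
    field
      e₁∈E        : e₁ ∈ E
      e₂∈E        : e₂ ∈ E
      spanning    : ∀ {x} → x ∈ E →
                    ∃₂ λ r s → r ∈ K × s ∈ K × x ≈ r * e₁ + s * e₂
      independent : ∀ {r s} → r ∈ K → s ∈ K →
                    r * e₁ + s * e₂ ≈ 0# → r ≈ 0# × s ≈ 0#

  record IsQuadraticExtension (K : Pred Carrier k) (E : Pred Carrier e)
                              : Set (c ⊔ ℓ ⊔ k ⊔ e) where
    field
      base-isSubfield : IsSubfield K
      ext-isSubfield  : IsSubfield E
      base⊆ext        : K ⊆ E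
      degree-two      : ∃₂ λ e₁ e₂ → IsBasis₂ K E e₁ e₂

module _ (L : CommutativeRing c ℓ) where
  open CommutativeRing L
  open import Algebra.Properties.Semiring.Exp semiring using (_^_)

  -- Membership in (L*)^n.
  IsPowerOfUnit : ℕ → Pred Carrier (c ⊔ ℓ)
  IsPowerOfUnit n x = ∃[ u ] ¬ u ≈ 0# × u ^ n ≈ x

  record Quadruple : Set c where
    constructor [_,_,_,_]
    field
      p₁ p₂ p₃ p₄ : Carrier

  Legitimate : ℕ → Quadruple → Set (c ⊔ ℓ)
  Legitimate s [ p₁ , p₂ , p₃ , p₄ ] =
    ¬ p₁ ≈ 0# ×
    (∀ x → ¬ p₁ * x ^ (σ ℕ.+ 1) + p₂ * x ^ σ + p₃ * x + p₄ ≈ 0#)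
    where
    σ : ℕ
    σ = 2 ℕ.^ s

  B-group : AbelianGroup c ℓ
  B-group = abelianGroup +-abelianGroup +-abelianGroup

  B-mul : ℕ → Carrier → Quadruple → Op₂ (Carrier × Carrier)
  B-mul s l [ p₁ , p₂ , p₃ , p₄ ] (a , b) (c , d) =
    ( p₁ * a * c ^ σ + l * p₁ * a ^ σ * c
    + p₂ * b * c ^ σ + l * p₂ * a ^ σ * d
    + p₃ * a * d ^ σ + l * p₃ * b ^ σ * c
    + p₄ * b * d ^ σ + l * p₄ * b ^ σ * d
    , a * d + b * c )
    where
    σ : ℕ
    σ = 2 ℕ.^ s

  IsotopicToB : NonAssociativeRing a ℓ₁ → ℕ → Carrier → Quadruple →
                Set (a ⊔ ℓ₁ ⊔ c ⊔ ℓ)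
  IsotopicToB S s l t =
    Isotopic (NonAssociativeRing.+-abelianGroup S) (NonAssociativeRing._*_ S)
             B-group (B-mul s l t)

module Submission where

-- Write x ∘ y = (Φ(x, y^σ) + l Φ(y, x^σ), det(x, y)) with Φ bilinear over L, and Φ(x, y^σ) = κ det(x, T y)
-- with T σ-semilinear and scaled (square roots exist in L) so that det(T x, T y) = σ(det(x, y)).
-- Legitimacy of t says det(x, T x) ≠ 0 for x ≠ 0.
--
-- The middle nucleus of an isotope corresponds to the pairs (A, B) with A x ∘ y = x ∘ B y. The
-- second coordinate makes A L-linear with adjoint B, and then, as σ ≠ 1, the first one says that A
-- commutes with T. If σ has order n, then N = Tⁿ is L-linear, preserves det and commutes with T. It
-- is not a scalar: a scalar of determinant 1 is 1 in characteristic 2, and if Tⁿ = 1, then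
-- 1 + T + … + Tⁿ⁻¹ takes values in the fixed vectors of T, which vanish, against Dedekind independence.
-- So the A commuting with N are the α + βN, and those commuting with T have α, β in the fixed
-- field of σ.
--
-- Such scalars are central. Conversely a central A satisfies A x ∘ y = C (x ∘ y), and comparing
-- x ∘ kx with (μx) ∘ (μx) for a suitable k, which exists as l is not a (σ−1)-st power, gives
-- det(x, A x) = 0 for all x. So N is not central.

open import Defs
open import Algebra.Bundles
  using (AbelianGroup; CommutativeMonoid; CommutativeRing; NonAssociativeRing; Semiring)
open import Algebra.Morphism.Structures using (module GroupMorphisms; module SemiringMorphisms)
import Algebra.Properties.Group as GroupProperties
open import Algebra.Solver.Ring.AlmostCommutativeRing
  using (fromCommutativeSemiring; _-Raw-AlmostCommutative⟶_)
import Algebra.Solver.Ring as RingSolver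
open import Data.Bool.Base using (Bool; true; false; _xor_; _∧_)
import Data.Bool.Properties as Bool
open import Data.Fin.Base using (Fin; zero; suc; punchIn)
open import Data.Fin.Permutation using (Permutation; permutation)
import Data.Fin.Properties as Fin
open import Data.List.Base using (List; []; _∷_; length; replicate)
open import Data.List.Properties using (length-replicate)
open import Data.Maybe.Base using (Maybe; just; nothing)
open import Data.Nat.Base as ℕ using (ℕ; zero; suc; z≤n; s≤s)
open import Data.Nat.GeneralisedArithmetic using (fold)
import Data.Nat.Properties as ℕ
open import Data.Product.Base using (_×_; _,_; ∃-syntax; ∃₂; proj₁; proj₂)
open import Data.Sum.Base using (_⊎_; inj₁; inj₂)
open import Function.Base using (_∘_; id)
open import Function.Bundles using (Inverse)
open import Function.Definitions using (Congruent; Injective)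
open import Function.Properties.Bijection using (Bijection⇒Inverse)
open import Level using (_⊔_)
open import Relation.Binary.Bundles using (Setoid)
open import Relation.Binary.Definitions using (Decidable)
open import Relation.Binary.PropositionalEquality using (_≡_; _≢_)
import Relation.Binary.PropositionalEquality as ≡
import Relation.Binary.Reasoning.Setoid as SetoidReasoning
open import Relation.Nullary.Decidable.Core using (yes; no; map′; decidable-stable)
open import Relation.Nullary.Negation.Core using (¬_; contradiction)
open import Relation.Unary using (_∈_; _∉_; _⊆_)

-- Finite sets and finite fields

-- Isotopy does not respect the identity element, so nuclei are not compared element by element. An
-- element u is middle-nuclear when the maps x ↦ x u and y ↦ u y satisfy (x u) y = x (u y). This is
-- a condition on a pair of maps, which an isotopism carries to the plane and back; u is recovered
-- by evaluating at 1. The center is treated alike, with triples of maps. The bounds on s provide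
-- some μ with σ(μ) ≠ μ, and everything that separates linear from σ-semilinear behaviour is done by
-- replacing x with μ x. That l is not a (σ-1)-st power makes k ↦ σ(k) + l k injective, hence
-- bijective on the finite field; this is what keeps N out of the center. The scaling of T matters
-- because N would otherwise multiply det by the norm of the determinant of T, and would not be an
-- isometry. Fixed vectors of T vanish because T x = x gives det(x, T x) = det(x, x) = 0.

injective⇒strictlySurjective-Fin : ∀ {n} {f : Fin n → Fin n} →
  Injective _≡_ _≡_ f → ∀ y → ∃[ x ] f x ≡ y
injective⇒strictlySurjective-Fin {n} {f} f-inj y with Fin.any? (λ x → f x Fin.≟ y)
... | yes hit  = hit
... | no  miss = contradiction (Fin.injective⇒≤ y∷f-injective) ℕ.1+n≰n
  where
  -- Pigeonhole: prepending a missed value to `f` would inject `suc n` elements into `n`.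
  y∷f : Fin (suc n) → Fin n
  y∷f zero    = y
  y∷f (suc i) = f i

  y∷f-injective : Injective _≡_ _≡_ y∷f
  y∷f-injective {zero}  {zero}  eq = ≡.refl
  y∷f-injective {zero}  {suc j} eq = contradiction (j , ≡.sym eq) miss
  y∷f-injective {suc i} {zero}  eq = contradiction (i , eq) miss
  y∷f-injective {suc i} {suc j} eq = ≡.cong suc (f-inj eq)

module Finite {c ℓ} (A : Setoid c ℓ) {n : ℕ} (card : HasCardinality A n) where
  open Setoid A
  open Inverse card

  to-injective : ∀ {x y} → to x ≡ to y → x ≈ y
  to-injective {x} {y} eq =
    trans (sym (strictlyInverseʳ x)) (trans (from-cong eq) (strictlyInverseʳ y))

  from-injective : ∀ {i j} → from i ≈ from j → i ≡ j
  from-injective {i} {j} eq =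
    ≡.trans (≡.sym (strictlyInverseˡ i)) (≡.trans (to-cong eq) (strictlyInverseˡ j))

  infix 4 _≟_
  _≟_ : Decidable _≈_
  x ≟ y = map′ to-injective to-cong (to x Fin.≟ to y)

  injective⇒strictlySurjective : ∀ {f : Carrier → Carrier} →
    Injective _≈_ _≈_ f → ∀ y → ∃[ x ] f x ≈ y
  injective⇒strictlySurjective {f} f-inj y =
    let i , eq = injective⇒strictlySurjective-Fin
                   (from-injective ∘ f-inj ∘ to-injective) (to y)
    in from i , to-injective eq

  -- The carrier can be searched through `Fin n`, so a failed identity yields an explicit witness;
  -- this is how elements moved by powers of Frobenius are found.
  all⊎counterexample : ∀ {f g : Carrier → Carrier} →
    Congruent _≈_ _≈_ f → Congruent _≈_ _≈_ g →
    (∀ x → f x ≈ g x) ⊎ ∃[ x ] ¬ f x ≈ g x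
  all⊎counterexample {f} {g} f-cong g-cong
    with Fin.all? (λ i → f (from i) ≟ g (from i))
  ... | yes all = inj₁ λ x →
          trans (f-cong (sym (strictlyInverseʳ x)))
            (trans (all (to x)) (g-cong (strictlyInverseʳ x)))
  ... | no ¬all =
          let i , neq = Fin.¬∀⟶∃¬ n _ (λ i → f (from i) ≟ g (from i)) ¬all
          in inj₂ (from i , neq)

module Field {c ℓ} {L : CommutativeRing c ℓ} (isField : IsField L) where
  open CommutativeRing L hiding (zero)
  open IsField isField
  open SetoidReasoning setoid

  *-cancelˡ : ∀ {x y z} → ¬ x ≈ 0# → x * y ≈ x * z → y ≈ z
  *-cancelˡ {x} {y} {z} x≉0 eq =
    let x⁻¹ , xx⁻¹≈1 = inverse x x≉0
        cancel = λ w → begin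
          x⁻¹ * (x * w)  ≈⟨ *-assoc x⁻¹ x w ⟨
          x⁻¹ * x * w    ≈⟨ *-congʳ (trans (*-comm x⁻¹ x) xx⁻¹≈1) ⟩
          1# * w         ≈⟨ *-identityˡ w ⟩
          w              ∎
    in trans (sym (cancel y)) (trans (*-congˡ eq) (cancel z))

  x*y≈0⇒y≈0 : ∀ {x y} → ¬ x ≈ 0# → x * y ≈ 0# → y ≈ 0#
  x*y≈0⇒y≈0 {x} x≉0 eq = *-cancelˡ x≉0 (trans eq (sym (zeroʳ x)))

  x*y≉0 : ∀ {x y} → ¬ x ≈ 0# → ¬ y ≈ 0# → ¬ x * y ≈ 0#
  x*y≉0 x≉0 y≉0 eq = y≉0 (x*y≈0⇒y≈0 x≉0 eq)

module Product {c ℓ} (M : CommutativeMonoid c ℓ) where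
  open CommutativeMonoid M
  open import Algebra.Properties.CommutativeMonoid.Sum M
  open import Algebra.Properties.CommutativeMonoid.Mult M using () renaming (_×_ to _·_)

  -- The one neutral summand leaves a gap that the extra `x` fills. In the field the gap is the
  -- index of 0, so the exponent is q and never q - 1.
  x∙sum≈n·x : ∀ {n} {x} (f : Fin n → Carrier) i → f i ≈ ε →
    (∀ j → j ≢ i → f j ≈ x) → x ∙ sum f ≈ n · x
  x∙sum≈n·x {suc n} {x} f i fi≈ε fj≈x = ∙-congˡ (begin
    sum f                                ≈⟨ sum-remove f ⟩
    f i ∙ sum (λ j → f (punchIn i j))    ≈⟨ ∙-congʳ fi≈ε ⟩
    ε ∙ sum (λ j → f (punchIn i j))      ≈⟨ identityˡ _ ⟩
    sum (λ j → f (punchIn i j))          ≈⟨ sum-cong-≋ (λ j → fj≈x _ (Fin.punchInᵢ≢i i j)) ⟩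
    sum (λ (j : Fin n) → x)              ≈⟨ sum-replicate n ⟩
    n · x                                ∎)
    where open SetoidReasoning setoid

module FiniteField {c ℓ} {L : CommutativeRing c ℓ} {q} (gf : IsGF q L) where
  open CommutativeRing L hiding (zero)
  open IsGF gf
  open IsField isField
  open Inverse cardinality using (to; from; to-cong; strictlyInverseˡ; strictlyInverseʳ)
  open Field isField
  open Finite setoid cardinality
  open SetoidReasoning setoid
  open import Algebra.Properties.Semiring.Exp semiring using (_^_; ^-congˡ)
  open import Algebra.Properties.CommutativeMonoid.Sum *-commutativeMonoid
    renaming (sum to ∏; sum-cong-≋ to ∏-cong; ∑-distrib-+ to ∏-distrib-*; sum-permute to ∏-permute)
  open Product *-commutativeMonoid using (x∙sum≈n·x)

  private
    -- Sending 0 to 1 turns a product over all of `Fin q` into the product of the nonzero elements.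
    unit : Carrier → Carrier
    unit y with y ≟ 0#
    ... | yes _ = 1#
    ... | no  _ = y

    -- the factor by which multiplication by x changes the unit of y
    factor : Carrier → Carrier → Carrier
    factor x y with y ≟ 0#
    ... | yes _ = 1#
    ... | no  _ = x

    unit-cong : ∀ {y z} → y ≈ z → unit y ≈ unit z
    unit-cong {y} {z} y≈z with y ≟ 0# | z ≟ 0#
    ... | yes _   | yes _   = refl
    ... | yes y≈0 | no  z≉0 = contradiction (trans (sym y≈z) y≈0) z≉0
    ... | no  y≉0 | yes z≈0 = contradiction (trans y≈z z≈0) y≉0
    ... | no  _   | no  _   = y≈z

    unit≉0 : ∀ y → ¬ unit y ≈ 0#
    unit≉0 y with y ≟ 0#
    ... | yes _   = 1≉0
    ... | no  y≉0 = y≉0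

    unit-* : ∀ {x} → ¬ x ≈ 0# → ∀ y → unit (x * y) ≈ factor x y * unit y
    unit-* {x} x≉0 y with y ≟ 0# | x * y ≟ 0#
    ... | yes _   | yes _    = sym (*-identityˡ 1#)
    ... | yes y≈0 | no  xy≉0 = contradiction (trans (*-congˡ y≈0) (zeroʳ x)) xy≉0
    ... | no  y≉0 | yes xy≈0 = contradiction xy≈0 (x*y≉0 x≉0 y≉0)
    ... | no  _   | no  _    = refl

    factor-0 : ∀ x {y} → y ≈ 0# → factor x y ≈ 1#
    factor-0 x {y} y≈0 with y ≟ 0#
    ... | yes _   = refl
    ... | no  y≉0 = contradiction y≈0 y≉0

    factor-≉0 : ∀ x {y} → ¬ y ≈ 0# → factor x y ≈ x
    factor-≉0 x {y} y≉0 with y ≟ 0#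
    ... | yes y≈0 = contradiction y≈0 y≉0
    ... | no  _   = refl

    ∏≉0 : ∀ {n} (f : Fin n → Carrier) → (∀ i → ¬ f i ≈ 0#) → ¬ ∏ f ≈ 0#
    ∏≉0 {zero}  f f≉0 = 1≉0
    ∏≉0 {suc n} f f≉0 = x*y≉0 (f≉0 zero) (∏≉0 (f ∘ suc) (f≉0 ∘ suc))

    scaling : ∀ {x} → ¬ x ≈ 0# → Permutation q q
    scaling {x} x≉0 = permutation (λ i → to (x * from i)) (λ i → to (x⁻¹ * from i))
      (undo xx⁻¹≈1) (undo (trans (*-comm x⁻¹ x) xx⁻¹≈1))
      where
      x⁻¹ = proj₁ (inverse x x≉0)
      xx⁻¹≈1 = proj₂ (inverse x x≉0)
      undo : ∀ {y z} → y * z ≈ 1# → ∀ i → to (y * from (to (z * from i))) ≡ i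
      undo {y} {z} yz≈1 i = from-injective (begin
        from (to (y * from (to (z * from i))))  ≈⟨ strictlyInverseʳ _ ⟩
        y * from (to (z * from i))              ≈⟨ *-congˡ (strictlyInverseʳ _) ⟩
        y * (z * from i)                        ≈⟨ *-assoc y z _ ⟨
        y * z * from i                          ≈⟨ *-congʳ yz≈1 ⟩
        1# * from i                             ≈⟨ *-identityˡ _ ⟩
        from i                                  ∎)

  0^q≈0 : 0# ^ q ≈ 0#
  -- The element 0 itself shows that `Fin q` is inhabited, hence that q is positive.
  0^q≈0 = nonempty (to 0#)
    where
    nonempty : ∀ {n} → Fin n → 0# ^ n ≈ 0#
    nonempty {suc n} _ = zeroˡ _

  -- Multiplication by x permutes the nonzero elements, so it leaves their product fixed.
  x^q≈x : ∀ x → x ^ q ≈ x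
  x^q≈x x with x ≟ 0#
  ... | yes x≈0 = trans (^-congˡ q x≈0) (trans 0^q≈0 (sym x≈0))
  ... | no  x≉0 = begin
    x ^ q         ≈⟨ x∙sum≈n·x F (to 0#) (factor-0 x (strictlyInverseʳ 0#))
                       (λ j j≢0 → factor-≉0 x (λ eq → j≢0 (≡.trans (≡.sym (strictlyInverseˡ j)) (to-cong eq)))) ⟨
    x * ∏ F       ≈⟨ *-congˡ ∏F≈1 ⟩
    x * 1#        ≈⟨ *-identityʳ x ⟩
    x             ∎
    where
    F U : Fin q → Carrier
    F i = factor x (from i)
    U i = unit (from i)
    ∏F≈1 : ∏ F ≈ 1#
    ∏F≈1 = *-cancelˡ (∏≉0 U (λ i → unit≉0 (from i))) (begin
      ∏ U * ∏ F                            ≈⟨ *-comm _ _ ⟩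
      ∏ F * ∏ U                            ≈⟨ ∏-distrib-* F U ⟨
      ∏ (λ i → F i * U i)                  ≈⟨ ∏-cong {q} (λ i → unit-* x≉0 (from i)) ⟨
      ∏ (λ i → unit (x * from i))          ≈⟨ ∏-cong {q} (λ i → unit-cong (strictlyInverseʳ (x * from i))) ⟨
      ∏ (λ i → U (to (x * from i)))        ≈⟨ ∏-permute U (scaling x≉0) ⟨
      ∏ U                                  ≈⟨ *-identityʳ _ ⟨
      ∏ U * 1#                             ∎)

-- Arithmetic and polynomials in characteristic 2

CharTwo : ∀ {c ℓ} → CommutativeRing c ℓ → Set ℓ
CharTwo L = 1# + 1# ≈ 0#
  where open CommutativeRing L

-- The ring solver with coefficients in GF(2), so that it knows x + x = 0.
module CharTwoSolver {c ℓ} {L : CommutativeRing c ℓ} (1+1≈0 : CharTwo L) where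
  open CommutativeRing L

  private
    embed : Bool → Carrier
    embed true  = 1#
    embed false = 0#

    embed-+ : ∀ a b → embed (a xor b) ≈ embed a + embed b
    embed-+ true  true  = sym 1+1≈0
    embed-+ true  false = sym (+-identityʳ 1#)
    embed-+ false b     = sym (+-identityˡ (embed b))

    embed-* : ∀ a b → embed (a ∧ b) ≈ embed a * embed b
    embed-* true  b = sym (*-identityˡ (embed b))
    embed-* false b = sym (zeroˡ (embed b))

    morphism : CommutativeRing.rawRing Bool.xor-∧-commutativeRing
                 -Raw-AlmostCommutative⟶ fromCommutativeSemiring commutativeSemiring
    morphism = record
      { ⟦_⟧    = embed
      ; +-homo = embed-+
      ; *-homo = embed-*
      -- Negation is the identity on both sides: in the Boolean ring, and in an almost commutative
      -- ring made from a semiring.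
      ; -‿homo = λ _ → refl
      ; 0-homo = refl
      ; 1-homo = refl
      }

    embed-≟ : ∀ a b → Maybe (embed a ≈ embed b)
    embed-≟ true  true  = just refl
    embed-≟ false false = just refl
    embed-≟ _     _     = nothing

  open RingSolver (CommutativeRing.rawRing Bool.xor-∧-commutativeRing)
    (fromCommutativeSemiring commutativeSemiring) morphism embed-≟ public
    using (solve; _:=_; _:+_; _:*_; con)

module CharTwoField {c ℓ} {L : CommutativeRing c ℓ} (isField : IsField L) (1+1≈0 : CharTwo L) where
  open CommutativeRing L hiding (zero)
  open IsField isField
  open Field isField
  open CharTwoSolver {L = L} 1+1≈0
  open SetoidReasoning setoid

  x+x≈0 : ∀ x → x + x ≈ 0#
  x+x≈0 = solve 1 (λ x → x :+ x := con false) refl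

  x+y≈0⇒x≈y : ∀ {x y} → x + y ≈ 0# → x ≈ y
  x+y≈0⇒x≈y {x} {y} eq = begin
    x            ≈⟨ solve 2 (λ x y → x := (x :+ y) :+ y) refl x y ⟩
    (x + y) + y  ≈⟨ +-congʳ eq ⟩
    0# + y       ≈⟨ +-identityˡ y ⟩
    y            ∎

  x≈y⇒x+y≈0 : ∀ {x y} → x ≈ y → x + y ≈ 0#
  x≈y⇒x+y≈0 {x} {y} eq = trans (+-congʳ eq) (x+x≈0 y)

  -- The list c₀ ∷ … ∷ c_{d-1} encodes the monic polynomial X^d + c_{d-1} X^(d-1) + … + c₀.
  ⟦_⟧ᴹ : List Carrier → Carrier → Carrier
  ⟦ []     ⟧ᴹ x = 1#
  ⟦ c ∷ cs ⟧ᴹ x = c + x * ⟦ cs ⟧ᴹ x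

  private
    -- Synthetic division by X + a: the coefficients of the quotient are the values at `a` of the
    -- successive tails. The quotient of a monic polynomial is monic, so the encoding is preserved.
    quotient : Carrier → Carrier → List Carrier → List Carrier
    quotient a c []       = []
    quotient a c (d ∷ cs) = ⟦ d ∷ cs ⟧ᴹ a ∷ quotient a d cs

    length-quotient : ∀ a c cs → length (quotient a c cs) ≡ length cs
    length-quotient a c []       = ≡.refl
    length-quotient a c (d ∷ cs) = ≡.cong suc (length-quotient a d cs)

    division : ∀ a c cs x →
      ⟦ c ∷ cs ⟧ᴹ x ≈ (x + a) * ⟦ quotient a c cs ⟧ᴹ x + ⟦ c ∷ cs ⟧ᴹ a
    division a c [] x =
      solve 3 (λ x a c → c :+ x :* con true := (x :+ a) :* con true :+ (c :+ a :* con true)) refl x a c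
    division a c (d ∷ cs) x = trans (+-congˡ (*-congˡ (division a d cs x)))
      (solve 5 (λ x a c q r → c :+ x :* ((x :+ a) :* q :+ r)
                            := (x :+ a) :* (r :+ x :* q) :+ (c :+ a :* r))
        refl x a c (⟦ quotient a d cs ⟧ᴹ x) (⟦ d ∷ cs ⟧ᴹ a))

  -- Divide by X + a for the first root a. Any other root r has r + a ≠ 0, so it remains a root of
  -- the quotient, whose degree is one less.
  roots≤degree : ∀ cs {k} (r : Fin k → Carrier) → Injective _≡_ _≈_ r →
    (∀ i → ⟦ cs ⟧ᴹ (r i) ≈ 0#) → k ℕ.≤ length cs
  roots≤degree cs       {zero}  r r-inj root = z≤n
  roots≤degree []       {suc k} r r-inj root = contradiction (root zero) 1≉0
  roots≤degree (c ∷ cs) {suc k} r r-inj root =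
    s≤s (≡.subst (k ℕ.≤_) (length-quotient a c cs)
      (roots≤degree (quotient a c cs) (r ∘ suc) (Fin.suc-injective ∘ r-inj) λ i →
        x*y≈0⇒y≈0 (λ eq → Fin.0≢1+n (r-inj (sym (x+y≈0⇒x≈y eq)))) (begin
          (r (suc i) + a) * ⟦ quotient a c cs ⟧ᴹ (r (suc i))                     ≈⟨ +-identityʳ _ ⟨
          (r (suc i) + a) * ⟦ quotient a c cs ⟧ᴹ (r (suc i)) + 0#                ≈⟨ +-congˡ (root zero) ⟨
          (r (suc i) + a) * ⟦ quotient a c cs ⟧ᴹ (r (suc i)) + ⟦ c ∷ cs ⟧ᴹ a     ≈⟨ division a c cs _ ⟨
          ⟦ c ∷ cs ⟧ᴹ (r (suc i))                                                ≈⟨ root (suc i) ⟩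
          0#                                                                     ∎)))
    where a = r zero

-- A failed test returns the evidence `Q`, so that minimality comes with positive information, here
-- an explicit moved element for every smaller exponent.
least : ∀ {p q} {P : ℕ → Set p} {Q : ℕ → Set q} → (∀ j → P j ⊎ Q j) →
  ∀ k → P k → ∃[ n ] P n × (∀ {j} → j ℕ.< n → Q j)
least test k p with test 0
least test k       p | inj₁ p₀ = 0 , p₀ , λ ()
least test zero    p | inj₂ q₀ = 0 , p , λ ()
least test (suc k) p | inj₂ q₀ =
  let n , pₙ , below = least (test ∘ suc) k p
  in suc n , pₙ , λ { {zero} _ → q₀ ; {suc j} (s≤s j<n) → below j<n }

-- Frobenius maps of GF(2^m)

module BinaryField {c ℓ} {L : CommutativeRing c ℓ} {m} (1≤m : 1 ℕ.≤ m) (gf : IsGF (2 ℕ.^ m) L) where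
  open CommutativeRing L hiding (zero)
  open import Algebra.Properties.CommutativeSemiring.Exp commutativeSemiring
  open import Algebra.Properties.Ring ring using (-1*x≈-x; -‿involutive)
  open IsGF gf
  open FiniteField {L = L} gf
  open Finite setoid cardinality
  open SetoidReasoning setoid

  1^n≈1 : ∀ n → 1# ^ n ≈ 1#
  1^n≈1 zero    = refl
  1^n≈1 (suc n) = trans (*-identityˡ _) (1^n≈1 n)

  -- An even power of -1 is 1, while its q-th power is -1; q is even because m is positive.
  1+1≈0 : CharTwo L
  1+1≈0 = trans (+-congˡ (sym (even 1≤m (x^q≈x (- 1#))))) (-‿inverseʳ 1#)
    where
    even : ∀ {m} → 1 ℕ.≤ m → (- 1#) ^ (2 ℕ.^ m) ≈ - 1# → - 1# ≈ 1#
    even {suc m} _ eq = begin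
      - 1#                             ≈⟨ eq ⟨
      (- 1#) ^ (2 ℕ.* 2 ℕ.^ m)         ≈⟨ ^-assocʳ (- 1#) 2 (2 ℕ.^ m) ⟨
      ((- 1#) ^ 2) ^ (2 ℕ.^ m)         ≈⟨ ^-congˡ (2 ℕ.^ m) (*-congˡ (*-identityʳ _)) ⟩
      (- 1# * - 1#) ^ (2 ℕ.^ m)        ≈⟨ ^-congˡ (2 ℕ.^ m) (trans (-1*x≈-x (- 1#)) (-‿involutive 1#)) ⟩
      1# ^ (2 ℕ.^ m)                   ≈⟨ 1^n≈1 (2 ℕ.^ m) ⟩
      1#                               ∎

  open CharTwoSolver {L = L} 1+1≈0
  open CharTwoField {L = L} isField 1+1≈0

  frobenius-+ : ∀ r x y → (x + y) ^ (2 ℕ.^ r) ≈ x ^ (2 ℕ.^ r) + y ^ (2 ℕ.^ r)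
  frobenius-+ zero    x y = solve 2 (λ x y → (x :+ y) :* con true := x :* con true :+ y :* con true) refl x y
  frobenius-+ (suc r) x y = begin
    (x + y) ^ (2 ℕ.* 2 ℕ.^ r)                       ≈⟨ ^-assocʳ (x + y) 2 (2 ℕ.^ r) ⟨
    ((x + y) ^ 2) ^ (2 ℕ.^ r)                       ≈⟨ ^-congˡ (2 ℕ.^ r) (square x y) ⟩
    (x ^ 2 + y ^ 2) ^ (2 ℕ.^ r)                     ≈⟨ frobenius-+ r (x ^ 2) (y ^ 2) ⟩
    (x ^ 2) ^ (2 ℕ.^ r) + (y ^ 2) ^ (2 ℕ.^ r)       ≈⟨ +-cong (^-assocʳ x 2 (2 ℕ.^ r)) (^-assocʳ y 2 (2 ℕ.^ r)) ⟩
    x ^ (2 ℕ.* 2 ℕ.^ r) + y ^ (2 ℕ.* 2 ℕ.^ r)       ∎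
    where
    square : ∀ x y → (x + y) ^ 2 ≈ x ^ 2 + y ^ 2
    square = solve 2 (λ x y → (x :+ y) :* ((x :+ y) :* con true)
                            := x :* (x :* con true) :+ y :* (y :* con true)) refl

  -- The root is x to the power q/2, whose square is x^q = x.
  sqrt : ∀ x → ∃[ y ] y * y ≈ x
  sqrt x = root 1≤m (x^q≈x x)
    where
    root : ∀ {m} → 1 ℕ.≤ m → x ^ (2 ℕ.^ m) ≈ x → ∃[ y ] y * y ≈ x
    root {suc m} _ eq = x ^ (2 ℕ.^ m) , (begin
      x ^ (2 ℕ.^ m) * x ^ (2 ℕ.^ m)             ≈⟨ *-congˡ (*-identityʳ _) ⟨
      (x ^ (2 ℕ.^ m)) ^ 2                       ≈⟨ ^-assocʳ x (2 ℕ.^ m) 2 ⟩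
      x ^ (2 ℕ.^ m ℕ.* 2)                       ≈⟨ ^-congʳ x (ℕ.*-comm (2 ℕ.^ m) 2) ⟩
      x ^ (2 ℕ.^ suc m)                         ≈⟨ eq ⟩
      x                                         ∎)

  x^dᵏ≈x : ∀ {d} → (∀ x → x ^ d ≈ x) → ∀ k x → x ^ (d ℕ.^ k) ≈ x
  x^dᵏ≈x {d} fix zero    x = *-identityʳ x
  x^dᵏ≈x {d} fix (suc k) x = begin
    x ^ (d ℕ.* d ℕ.^ k)    ≈⟨ ^-assocʳ x d (d ℕ.^ k) ⟨
    (x ^ d) ^ (d ℕ.^ k)    ≈⟨ ^-congˡ (d ℕ.^ k) (fix x) ⟩
    x ^ (d ℕ.^ k)          ≈⟨ x^dᵏ≈x fix k x ⟩
    x                      ∎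

  fold-^ : ∀ d k x → fold x (_^ d) k ≈ x ^ (d ℕ.^ k)
  fold-^ d zero    x = sym (*-identityʳ x)
  fold-^ d (suc k) x = begin
    (fold x (_^ d) k) ^ d     ≈⟨ ^-congˡ d (fold-^ d k x) ⟩
    (x ^ (d ℕ.^ k)) ^ d       ≈⟨ ^-assocʳ x (d ℕ.^ k) d ⟩
    x ^ (d ℕ.^ k ℕ.* d)       ≈⟨ ^-congʳ x (ℕ.*-comm (d ℕ.^ k) d) ⟩
    x ^ (d ℕ.* d ℕ.^ k)       ∎

  -- The m-fold iterate of the 2^s-th power map is also the s-fold iterate of x ↦ x^q. Thus σ has
  -- finite order, at most m.
  fold-frobenius≈id : ∀ s x → fold x (_^ (2 ℕ.^ s)) m ≈ x
  fold-frobenius≈id s x = begin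
    fold x (_^ (2 ℕ.^ s)) m    ≈⟨ fold-^ (2 ℕ.^ s) m x ⟩
    x ^ ((2 ℕ.^ s) ℕ.^ m)      ≈⟨ ^-congʳ x exponents ⟩
    x ^ ((2 ℕ.^ m) ℕ.^ s)      ≈⟨ x^dᵏ≈x x^q≈x s x ⟩
    x                          ∎
    where
    exponents : (2 ℕ.^ s) ℕ.^ m ≡ (2 ℕ.^ m) ℕ.^ s
    exponents = ≡.trans (ℕ.^-*-assoc 2 s m)
      (≡.trans (≡.cong (2 ℕ.^_) (ℕ.*-comm s m)) (≡.sym (ℕ.^-*-assoc 2 m s)))

  -- All q elements are roots of X^d + X. The list encodes it as a monic polynomial of degree d,
  -- which requires d ≥ 2: for d = 1 it is the zero polynomial.
  identity⇒q≤d : ∀ {d} → 2 ℕ.≤ d → (∀ x → x ^ d ≈ x) → 2 ℕ.^ m ℕ.≤ d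
  identity⇒q≤d {suc (suc k)} (s≤s (s≤s _)) fix =
    ≡.subst (λ e → 2 ℕ.^ m ℕ.≤ suc (suc e)) (length-replicate k)
      (roots≤degree (0# ∷ 1# ∷ replicate k 0#) (Inverse.from cardinality) from-injective λ i →
        let x = Inverse.from cardinality i in begin
        0# + x * (1# + x * ⟦ replicate k 0# ⟧ᴹ x)   ≈⟨ +-congˡ (*-congˡ (+-congˡ (*-congˡ (monomial k x)))) ⟩
        0# + x * (1# + x * x ^ k)                   ≈⟨ solve 2 (λ x y → con false :+ x :* (con true :+ x :* y) := x :+ x :* (x :* y)) refl x (x ^ k) ⟩
        x + x ^ suc (suc k)                         ≈⟨ +-congˡ (fix x) ⟩
        x + x                                       ≈⟨ x+x≈0 x ⟩
        0#                                          ∎)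
    where
    monomial : ∀ k x → ⟦ replicate k 0# ⟧ᴹ x ≈ x ^ k
    monomial zero    x = refl
    monomial (suc k) x = trans (+-identityˡ _) (*-congˡ (monomial k x))

  frobenius-id⇒m≤r : ∀ {r} → 0 ℕ.< r → (∀ x → x ^ (2 ℕ.^ r) ≈ x) → m ℕ.≤ r
  frobenius-id⇒m≤r {r} 0<r fix = ℕ.≮⇒≥ λ r<m →
    ℕ.<⇒≱ (ℕ.^-monoʳ-< 2 ℕ.≤-refl r<m) (identity⇒q≤d (ℕ.^-monoʳ-≤ 2 0<r) fix)

  -- A Frobenius map is the identity only if m divides its exponent, and s = m is the only multiple
  -- of m strictly between 0 and 2m. In the proof, s > m is reduced to s - m by cancelling x^q = x.
  frobenius-nontrivial : ∀ {s} → 0 ℕ.< s → s ℕ.< 2 ℕ.* m → s ≢ m →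
    ∃[ x ] ¬ x ^ (2 ℕ.^ s) ≈ x
  frobenius-nontrivial {s} 0<s s<2m s≢m
    with all⊎counterexample (^-congˡ (2 ℕ.^ s)) id
  ... | inj₂ found = found
  ... | inj₁ fix   = contradiction (frobenius-id⇒m≤r 0<r fixʳ) (ℕ.<⇒≱ r<m)
    where
    m<s : m ℕ.< s
    m<s = ℕ.≤∧≢⇒< (frobenius-id⇒m≤r 0<s fix) (s≢m ∘ ≡.sym)
    r = s ℕ.∸ m
    m+r≡s : m ℕ.+ r ≡ s
    m+r≡s = ℕ.m+[n∸m]≡n (ℕ.<⇒≤ m<s)
    0<r : 0 ℕ.< r
    0<r = ℕ.m<n⇒0<n∸m m<s
    r<m : r ℕ.< m
    r<m = ℕ.+-cancelˡ-< m r m (≡.subst₂ ℕ._<_ (≡.sym m+r≡s) (≡.cong (m ℕ.+_) (ℕ.+-identityʳ m)) s<2m)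
    fixʳ : ∀ x → x ^ (2 ℕ.^ r) ≈ x
    fixʳ x = begin
      x ^ (2 ℕ.^ r)                   ≈⟨ ^-congˡ (2 ℕ.^ r) (x^q≈x x) ⟨
      (x ^ (2 ℕ.^ m)) ^ (2 ℕ.^ r)     ≈⟨ ^-assocʳ x (2 ℕ.^ m) (2 ℕ.^ r) ⟩
      x ^ (2 ℕ.^ m ℕ.* 2 ℕ.^ r)       ≈⟨ ^-congʳ x (≡.trans (≡.sym (ℕ.^-distribˡ-+-* 2 m r)) (≡.cong (2 ℕ.^_) m+r≡s)) ⟩
      x ^ (2 ℕ.^ s)                   ≈⟨ fix x ⟩
      x                               ∎

  frobenius-order : ∀ s → ∃[ n ] (∀ x → fold x (_^ (2 ℕ.^ s)) (suc n) ≈ x)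
    × (∀ {j} → j ℕ.< n → ∃[ x ] ¬ fold x (_^ (2 ℕ.^ s)) (suc j) ≈ x)
  frobenius-order s =
    -- The index j stands for `suc j` iterations, which excludes the zeroth power; the known period
    -- m therefore appears as `pred m`.
    least (λ j → all⊎counterexample (fold-cong (suc j)) id) (ℕ.pred m)
      (λ x → ≡.subst (λ k → fold x (_^ (2 ℕ.^ s)) k ≈ x) (≡.sym (ℕ.suc-pred m {{ℕ.>-nonZero 1≤m}}))
               (fold-frobenius≈id s x))
    where
    fold-cong : ∀ j {x y} → x ≈ y → fold x (_^ (2 ℕ.^ s)) j ≈ fold y (_^ (2 ℕ.^ s)) j
    fold-cong zero    x≈y = x≈y
    fold-cong (suc j) x≈y = ^-congˡ (2 ℕ.^ s) (fold-cong j x≈y)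

-- The plane over a field of characteristic 2

module Plane {c ℓ} {L : CommutativeRing c ℓ} (isField : IsField L) (1+1≈0 : CharTwo L) where
  open CommutativeRing L hiding (zero)
  open IsField isField
  open Field isField
  open CharTwoSolver {L = L} 1+1≈0
  open CharTwoField {L = L} isField 1+1≈0

  open AbelianGroup (B-group L) public using ()
    renaming ( Carrier to V; _≈_ to infix 4 _≈ᵥ_; _∙_ to infixl 6 _+ᵥ_; ε to 0ᵥ; setoid to setoidᵥ
             ; refl to reflᵥ; sym to symᵥ; trans to transᵥ; ∙-cong to +ᵥ-cong)

  infixl 7 _·_
  _·_ : Carrier → V → V
  k · (a , b) = k * a , k * b

  ·-cong : ∀ {j k x y} → j ≈ k → x ≈ᵥ y → j · x ≈ᵥ k · y
  ·-cong j≈k (a , b) = *-cong j≈k a , *-cong j≈k b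

  ·-swap : ∀ j k x → j · (k · x) ≈ᵥ k · (j · x)
  ·-swap j k (a , b) = swap a , swap b
    where
    swap : ∀ a → j * (k * a) ≈ k * (j * a)
    swap = solve 3 (λ j k a → j :* (k :* a) := k :* (j :* a)) refl j k

  ·-+ᵥ : ∀ k x y → k · (x +ᵥ y) ≈ᵥ k · x +ᵥ k · y
  ·-+ᵥ k (a , b) (c , d) = distribˡ k a c , distribˡ k b d

  1·x≈x : ∀ x → 1# · x ≈ᵥ x
  1·x≈x (a , b) = *-identityˡ a , *-identityˡ b

  +ᵥ-interchange : ∀ x y z w → (x +ᵥ y) +ᵥ (z +ᵥ w) ≈ᵥ (x +ᵥ z) +ᵥ (y +ᵥ w)
  +ᵥ-interchange (a , a′) (b , b′) (c , c′) (d , d′) = swap a b c d , swap a′ b′ c′ d′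
    where
    swap : ∀ a b c d → (a + b) + (c + d) ≈ (a + c) + (b + d)
    swap = solve 4 (λ a b c d → (a :+ b) :+ (c :+ d) := (a :+ c) :+ (b :+ d)) refl

  det : V → V → Carrier
  det (a , b) (c , d) = a * d + b * c

  det-cong : ∀ {x y z w} → x ≈ᵥ y → z ≈ᵥ w → det x z ≈ det y w
  det-cong (a , b) (c , d) = +-cong (*-cong a d) (*-cong b c)

  det-congˡ : ∀ {x z w} → z ≈ᵥ w → det x z ≈ det x w
  det-congˡ = det-cong reflᵥ

  det-congʳ : ∀ {x y z} → x ≈ᵥ y → det x z ≈ det y z
  det-congʳ x≈y = det-cong x≈y reflᵥ

  det-comm : ∀ x y → det x y ≈ det y x
  det-comm (a , b) (c , d) =
    solve 4 (λ a b c d → a :* d :+ b :* c := c :* b :+ d :* a) refl a b c d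

  det-alternating : ∀ x → det x x ≈ 0#
  det-alternating (a , b) = solve 2 (λ a b → a :* b :+ b :* a := con false) refl a b

  det-+ˡ : ∀ x y z → det (x +ᵥ y) z ≈ det x z + det y z
  det-+ˡ (a , b) (c , d) (e , f) =
    solve 6 (λ a b c d e f → (a :+ c) :* f :+ (b :+ d) :* e
                           := (a :* f :+ b :* e) :+ (c :* f :+ d :* e)) refl a b c d e f

  det-+ʳ : ∀ x y z → det x (y +ᵥ z) ≈ det x y + det x z
  det-+ʳ x y z = trans (det-comm x _) (trans (det-+ˡ y z x) (+-cong (det-comm y x) (det-comm z x)))

  det-·ˡ : ∀ k x y → det (k · x) y ≈ k * det x y
  det-·ˡ k (a , b) (c , d) =
    solve 5 (λ k a b c d → k :* a :* d :+ k :* b :* c := k :* (a :* d :+ b :* c)) refl k a b c d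

  det-·ʳ : ∀ k x y → det x (k · y) ≈ k * det x y
  det-·ʳ k x y = trans (det-comm x _) (trans (det-·ˡ k y x) (*-congˡ (det-comm y x)))

  e₁ e₂ : V
  e₁ = 1# , 0#
  e₂ = 0# , 1#

  -- Pairing with `e₂` and `e₁` reads off the two coordinates.
  det-nondegenerate : ∀ {x y} → (∀ z → det x z ≈ det y z) → x ≈ᵥ y
  det-nondegenerate {x} {y} eq =
      trans (sym (first x)) (trans (eq e₂) (first y))
    , trans (sym (second x)) (trans (eq e₁) (second y))
    where
    first : ∀ x → det x e₂ ≈ proj₁ x
    first (a , b) = solve 2 (λ a b → a :* con true :+ b :* con false := a) refl a b
    second : ∀ x → det x e₁ ≈ proj₂ x
    second (a , b) = solve 2 (λ a b → a :* con false :+ b :* con true := b) refl a b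

  det≈0⇒≈0ᵥ : ∀ {x} → (∀ z → det x z ≈ 0#) → x ≈ᵥ 0ᵥ
  det≈0⇒≈0ᵥ eq = det-nondegenerate λ { (a , b) → trans (eq (a , b))
    (solve 2 (λ a b → con false := con false :* b :+ con false :* a) refl a b) }

  x+y≈0⇒x≈y-ᵥ : ∀ {x y} → x +ᵥ y ≈ᵥ 0ᵥ → x ≈ᵥ y
  x+y≈0⇒x≈y-ᵥ (p , q) = x+y≈0⇒x≈y p , x+y≈0⇒x≈y q

  -- Cramer's rule: det(x,y) z = det(z,y) x + det(x,z) y.
  basis : ∀ {x y} → ¬ det x y ≈ 0# → ∀ z → ∃₂ λ α β → z ≈ᵥ α · x +ᵥ β · y
  basis {a , b} {c , d} det≉0 (e , f) =
    let δ , detδ≈1 = inverse (a * d + b * c) det≉0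
        scale = λ e → trans (sym (*-identityʳ e)) (*-congˡ (sym detδ≈1))
    in δ * (e * d + f * c) , δ * (a * f + b * e)
     , trans (scale e) (solve 7 (λ a b c d e f δ →
         e :* ((a :* d :+ b :* c) :* δ)
           := δ :* (e :* d :+ f :* c) :* a :+ δ :* (a :* f :+ b :* e) :* c) refl a b c d e f δ)
     , trans (scale f) (solve 7 (λ a b c d e f δ →
         f :* ((a :* d :+ b :* c) :* δ)
           := δ :* (e :* d :+ f :* c) :* b :+ δ :* (a :* f :+ b :* e) :* d) refl a b c d e f δ)

  record IsSemilinear (τ : Carrier → Carrier) (F : V → V) : Set (c ⊔ ℓ) where
    field
      F-cong : ∀ {x y} → x ≈ᵥ y → F x ≈ᵥ F y
      F-+    : ∀ x y → F (x +ᵥ y) ≈ᵥ F x +ᵥ F y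
      F-·    : ∀ k x → F (k · x) ≈ᵥ τ k · F x

  IsLinear : (V → V) → Set (c ⊔ ℓ)
  IsLinear = IsSemilinear id

  module _ {F : V → V} (lin : IsLinear F) where
    open IsSemilinear lin
    open SetoidReasoning setoidᵥ

    F-combination : ∀ α β x y → F (α · x +ᵥ β · y) ≈ᵥ α · F x +ᵥ β · F y
    F-combination α β x y = transᵥ (F-+ _ _) (+ᵥ-cong (F-· α x) (F-· β y))

  linear-extensionality : ∀ {F G x y} → IsLinear F → IsLinear G → ¬ det x y ≈ 0# →
    F x ≈ᵥ G x → F y ≈ᵥ G y → ∀ z → F z ≈ᵥ G z
  linear-extensionality {F} {G} {x} {y} F-lin G-lin det≉0 Fx≈Gx Fy≈Gy z =
    let α , β , z≈ = basis det≉0 z in begin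
    F z                      ≈⟨ IsSemilinear.F-cong F-lin z≈ ⟩
    F (α · x +ᵥ β · y)       ≈⟨ F-combination F-lin α β x y ⟩
    α · F x +ᵥ β · F y       ≈⟨ +ᵥ-cong (·-cong refl Fx≈Gx) (·-cong refl Fy≈Gy) ⟩
    α · G x +ᵥ β · G y       ≈⟨ F-combination G-lin α β x y ⟨
    G (α · x +ᵥ β · y)       ≈⟨ IsSemilinear.F-cong G-lin z≈ ⟨
    G z                      ∎
    where open SetoidReasoning setoidᵥ

  ·-linear : ∀ k → IsLinear (k ·_)
  ·-linear k = record { F-cong = ·-cong refl ; F-+ = ·-+ᵥ k ; F-· = ·-swap k }

  combination-linear : ∀ {F} → IsLinear F → ∀ α β → IsLinear (λ x → α · x +ᵥ β · F x)
  combination-linear {F} lin α β = record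
    { F-cong = λ x≈y → +ᵥ-cong (·-cong refl x≈y) (·-cong refl (F-cong x≈y))
    ; F-+    = λ x y → transᵥ (+ᵥ-cong (·-+ᵥ α x y) (transᵥ (·-cong refl (F-+ x y)) (·-+ᵥ β (F x) (F y))))
                         (+ᵥ-interchange _ _ _ _)
    ; F-·    = λ k x → transᵥ (+ᵥ-cong (·-swap α k x) (transᵥ (·-cong refl (F-· k x)) (·-swap β k (F x))))
                         (symᵥ (·-+ᵥ k _ _))
    }
    where open IsSemilinear lin

  -- Three test vectors suffice: if `e₁` and `e₂` are eigenvectors the matrix is diagonal, and if
  -- `e₁ +ᵥ e₂` is one too, the diagonal entries agree.
  cyclic⊎scalar : Decidable _≈_ → ∀ {F} → IsLinear F →
    (∃[ x ] ¬ det x (F x) ≈ 0#) ⊎ (∃[ k ] ∀ x → F x ≈ᵥ k · x)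
  cyclic⊎scalar _≟_ {F} lin
    with det e₁ (F e₁) ≟ 0# | det e₂ (F e₂) ≟ 0# | det (e₁ +ᵥ e₂) (F (e₁ +ᵥ e₂)) ≟ 0#
  ... | no ≉0 | _     | _     = inj₁ (_ , ≉0)
  ... | yes _ | no ≉0 | _     = inj₁ (_ , ≉0)
  ... | yes _ | yes _ | no ≉0 = inj₁ (_ , ≉0)
  ... | yes p | yes q | yes r = inj₂ (a , linear-extensionality lin (·-linear a) e₁e₂≉0 Fe₁ Fe₂)
    where
    open IsSemilinear lin
    a = proj₁ (F e₁)
    b = proj₂ (F e₁)
    c′ = proj₁ (F e₂)
    d = proj₂ (F e₂)
    b≈0 : b ≈ 0#
    b≈0 = trans (solve 2 (λ a b → b := con true :* b :+ con false :* a) refl a b) p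
    c≈0 : c′ ≈ 0#
    c≈0 = trans (solve 2 (λ c d → c := con false :* d :+ con true :* c) refl c′ d) q
    a≈d : a ≈ d
    a≈d = x+y≈0⇒x≈y (begin
      a + d                                               ≈⟨ solve 4 (λ a b c d → a :+ d :=
                                                               ((con true :+ con false) :* (b :+ d) :+ (con false :+ con true) :* (a :+ c)) :+ (b :+ c)) refl a b c′ d ⟩
      det (e₁ +ᵥ e₂) (F e₁ +ᵥ F e₂) + (b + c′)            ≈⟨ +-cong (trans (det-congˡ (symᵥ (F-+ e₁ e₂))) r) (+-cong b≈0 c≈0) ⟩
      0# + (0# + 0#)                                      ≈⟨ solve 0 (con false :+ (con false :+ con false) := con false) refl ⟩
      0#                                                  ∎)
      where open SetoidReasoning setoid
    e₁e₂≉0 : ¬ det e₁ e₂ ≈ 0#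
    e₁e₂≉0 eq = 1≉0 (trans (solve 0 (con true := con true :* con true :+ con false :* con false) refl) eq)
    Fe₁ : F e₁ ≈ᵥ a · e₁
    Fe₁ = sym (*-identityʳ a) , trans b≈0 (sym (zeroʳ a))
    Fe₂ : F e₂ ≈ᵥ a · e₂
    Fe₂ = trans c≈0 (sym (zeroʳ a)) , trans (sym a≈d) (sym (*-identityʳ a))

  -- Since x and F x form a basis, A x = α x + β F x for some α, β. Applying F gives the same
  -- formula at F x, and linearity extends it to the plane.
  cyclic-commutant : ∀ {F A x} → IsLinear F → IsLinear A → ¬ det x (F x) ≈ 0# →
    (∀ y → A (F y) ≈ᵥ F (A y)) → ∃₂ λ α β → ∀ y → A y ≈ᵥ α · y +ᵥ β · F y
  cyclic-commutant {F} {A} {x} F-lin A-lin det≉0 commute =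
    let α , β , Ax≈ = basis det≉0 (A x) in
    α , β , linear-extensionality A-lin (combination-linear F-lin α β) det≉0 Ax≈ (begin
      A (F x)                     ≈⟨ commute x ⟩
      F (A x)                     ≈⟨ IsSemilinear.F-cong F-lin Ax≈ ⟩
      F (α · x +ᵥ β · F x)        ≈⟨ F-combination F-lin α β x (F x) ⟩
      α · F x +ᵥ β · F (F x)      ∎)
    where open SetoidReasoning setoidᵥ

-- Semilinear maps and the operator N

module Twisted {c ℓ} {L : CommutativeRing c ℓ} (isField : IsField L) (1+1≈0 : CharTwo L)
               (_≟_ : Decidable (CommutativeRing._≈_ L)) where
  open CommutativeRing L hiding (zero)
  open IsField isField
  open Field isField
  open CharTwoSolver {L = L} 1+1≈0
  open CharTwoField {L = L} isField 1+1≈0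
  open Plane {L = L} isField 1+1≈0
  open SemiringMorphisms (Semiring.rawSemiring semiring) (Semiring.rawSemiring semiring) using (IsSemiringHomomorphism)
  private
    module ≈-Reasoning = SetoidReasoning setoid
    module ≈ᵥ-Reasoning = SetoidReasoning setoidᵥ

  record IsTwist (σ : Carrier → Carrier) (T : V → V) : Set (c ⊔ ℓ) where
    field
      σ-homomorphism : IsSemiringHomomorphism σ
      T-semilinear   : IsSemilinear σ T
      det-T          : ∀ x y → det (T x) (T y) ≈ σ (det x y)
      anisotropic    : ∀ {x} → det x (T x) ≈ 0# → x ≈ᵥ 0ᵥ

    open IsSemiringHomomorphism σ-homomorphism public using ()
      renaming (⟦⟧-cong to σ-cong; +-homo to σ-+; *-homo to σ-*; 0#-homo to σ-0; 1#-homo to σ-1)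
    open IsSemilinear T-semilinear public
      renaming (F-cong to T-cong; F-+ to T-+; F-· to T-·)

    σ-≉0 : ∀ {x} → ¬ x ≈ 0# → ¬ σ x ≈ 0#
    σ-≉0 {x} x≉0 σx≈0 = let x⁻¹ , xx⁻¹≈1 = inverse x x≉0 in 1≉0 (begin
      1#             ≈⟨ σ-1 ⟨
      σ 1#           ≈⟨ σ-cong xx⁻¹≈1 ⟨
      σ (x * x⁻¹)    ≈⟨ σ-* x x⁻¹ ⟩
      σ x * σ x⁻¹    ≈⟨ *-congʳ σx≈0 ⟩
      0# * σ x⁻¹     ≈⟨ zeroˡ _ ⟩
      0#             ∎)
      where open ≈-Reasoning

  -- The order of σ is suc n.
  record HasOrder (σ : Carrier → Carrier) (n : ℕ) : Set (c ⊔ ℓ) where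
    field
      period  : ∀ x → fold x σ (suc n) ≈ x
      minimal : ∀ {j} → j ℕ.< n → ∃[ x ] ¬ fold x σ (suc j) ≈ x

  module Powers {σ T n} (twist : IsTwist σ T) (order : HasOrder σ n) where
    open IsTwist twist
    open HasOrder order

    fold-semilinear : ∀ i → IsSemilinear (λ k → fold k σ i) (λ x → fold x T i)
    fold-semilinear zero    = record
      { F-cong = id ; F-+ = λ _ _ → reflᵥ ; F-· = λ _ _ → reflᵥ }
    fold-semilinear (suc i) = record
      { F-cong = T-cong ∘ F-cong
      ; F-+    = λ x y → transᵥ (T-cong (F-+ x y)) (T-+ _ _)
      ; F-·    = λ k x → transᵥ (T-cong (F-· k x)) (T-· _ _)
      }
      where open IsSemilinear (fold-semilinear i)

    det-fold : ∀ i x y → det (fold x T i) (fold y T i) ≈ fold (det x y) σ i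
    det-fold zero    x y = refl
    det-fold (suc i) x y = trans (det-T _ _) (σ-cong (det-fold i x y))

    fold-comm : ∀ i x → fold (T x) T i ≡ T (fold x T i)
    fold-comm zero    x = ≡.refl
    fold-comm (suc i) x = ≡.cong T (fold-comm i x)

    combination : (ℕ → Carrier) → ℕ → V → V
    combination k zero    x = k 0 · x
    combination k (suc j) x = combination k j x +ᵥ k (suc j) · fold x T (suc j)

    -- Moving μ past the i-th power of T turns it into σ^i(μ), so each coefficient picks up its own
    -- factor, and ν can be chosen to kill one of them.
    combination-twist : ∀ k j μ ν x →
      combination k j (μ · x) +ᵥ ν · combination k j x
        ≈ᵥ combination (λ i → k i * (fold μ σ i + ν)) j x
    combination-twist k j μ ν x = go j
      where
      term : ∀ k m w → k · (m · w) +ᵥ ν · (k · w) ≈ᵥ (k * (m + ν)) · w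
      term k m (a , b) = coordinate a , coordinate b
        where
        coordinate : ∀ a → k * (m * a) + ν * (k * a) ≈ (k * (m + ν)) * a
        coordinate = solve 4 (λ k m ν a → k :* (m :* a) :+ ν :* (k :* a) := (k :* (m :+ ν)) :* a) refl k m ν
      go : ∀ j → combination k j (μ · x) +ᵥ ν · combination k j x
                   ≈ᵥ combination (λ i → k i * (fold μ σ i + ν)) j x
      go zero    = term (k 0) μ x
      go (suc j) = begin
        (combination k j (μ · x) +ᵥ k (suc j) · fold (μ · x) T (suc j))
          +ᵥ ν · (combination k j x +ᵥ k (suc j) · fold x T (suc j))
            ≈⟨ +ᵥ-cong (+ᵥ-cong reflᵥ (·-cong refl (IsSemilinear.F-· (fold-semilinear (suc j)) μ x))) (·-+ᵥ ν _ _) ⟩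
        (combination k j (μ · x) +ᵥ k (suc j) · (fold μ σ (suc j) · fold x T (suc j)))
          +ᵥ (ν · combination k j x +ᵥ ν · (k (suc j) · fold x T (suc j)))
            ≈⟨ +ᵥ-interchange _ _ _ _ ⟩
        (combination k j (μ · x) +ᵥ ν · combination k j x)
          +ᵥ (k (suc j) · (fold μ σ (suc j) · fold x T (suc j)) +ᵥ ν · (k (suc j) · fold x T (suc j)))
            ≈⟨ +ᵥ-cong (go j) (term (k (suc j)) (fold μ σ (suc j)) (fold x T (suc j))) ⟩
        combination (λ i → k i * (fold μ σ i + ν)) (suc j) x ∎
        where open ≈ᵥ-Reasoning

    -- Dedekind's argument: the commutator with μ, corrected by ν = σʲ⁺¹ μ, removes the
    -- highest term of a relation and multiplies the constant one by μ + ν ≉ 0.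
    independence : ∀ j k → (∀ {i} → i ℕ.< j → ∃[ μ ] ¬ fold μ σ (suc i) ≈ μ) →
      (∀ x → combination k j x ≈ᵥ 0ᵥ) → k 0 ≈ 0#
    independence zero    k moved rel = trans (sym (*-identityʳ (k 0))) (proj₁ (rel e₁))
    independence (suc j) k moved rel =
      let μ , ν≉μ = moved ℕ.≤-refl
          ν       = fold μ σ (suc j)
          k′      = λ i → k i * (fold μ σ i + ν)
          shorter : ∀ x → combination k′ j x ≈ᵥ 0ᵥ
          shorter x = let open ≈ᵥ-Reasoning in begin
            combination k′ j x
              ≈⟨ dropZero (trans (*-congˡ (x+x≈0 ν)) (zeroʳ _)) (combination k′ j x) (fold x T (suc j)) ⟨
            combination k′ (suc j) x
              ≈⟨ combination-twist k (suc j) μ ν x ⟨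
            combination k (suc j) (μ · x) +ᵥ ν · combination k (suc j) x
              ≈⟨ +ᵥ-cong (rel (μ · x)) (·-cong refl (rel x)) ⟩
            0ᵥ +ᵥ ν · 0ᵥ
              ≈⟨ (trans (+-identityˡ _) (zeroʳ ν) , trans (+-identityˡ _) (zeroʳ ν)) ⟩
            0ᵥ ∎
      in x*y≈0⇒y≈0 (λ eq → ν≉μ (sym (x+y≈0⇒x≈y eq)))
           (trans (*-comm _ (k 0)) (independence j k′ (moved ∘ ℕ.m<n⇒m<1+n) shorter))
      where
      dropZero : ∀ {m} → m ≈ 0# → ∀ v w → v +ᵥ m · w ≈ᵥ v
      dropZero m≈0 (a , b) (c , d) = drop a c , drop b d
        where
        drop : ∀ a c → a + _ * c ≈ a
        drop a c = trans (+-congˡ (trans (*-congʳ m≈0) (zeroˡ c))) (+-identityʳ a)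

    orbitSum : ℕ → V → V
    orbitSum = combination (λ _ → 1#)

    -- Telescoping: T shifts the sum by one place, so only the two end terms differ.
    T-orbitSum : ∀ j x → T (orbitSum j x) +ᵥ x ≈ᵥ orbitSum j x +ᵥ fold x T (suc j)
    T-orbitSum zero    x = transᵥ (+ᵥ-cong (T-cong (1·x≈x x)) (symᵥ (1·x≈x x))) (comm (T x) (1# · x))
      where
      comm : ∀ x y → x +ᵥ y ≈ᵥ y +ᵥ x
      comm (a , b) (c , d) = +-comm a c , +-comm b d
    T-orbitSum (suc j) x = begin
      T (S +ᵥ 1# · w) +ᵥ x        ≈⟨ +ᵥ-cong (transᵥ (T-+ S _) (+ᵥ-cong reflᵥ (T-cong (1·x≈x w)))) reflᵥ ⟩
      (T S +ᵥ T w) +ᵥ x           ≈⟨ swap (T S) (T w) x ⟩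
      (T S +ᵥ x) +ᵥ T w           ≈⟨ +ᵥ-cong (T-orbitSum j x) reflᵥ ⟩
      (S +ᵥ w) +ᵥ T w             ≈⟨ +ᵥ-cong (+ᵥ-cong reflᵥ (1·x≈x w)) reflᵥ ⟨
      (S +ᵥ 1# · w) +ᵥ T w        ∎
      where
      open ≈ᵥ-Reasoning
      S = orbitSum j x
      w = fold x T (suc j)
      swap : ∀ x y z → (x +ᵥ y) +ᵥ z ≈ᵥ (x +ᵥ z) +ᵥ y
      swap (a , a′) (b , b′) (d , d′) = swap₁ a b d , swap₁ a′ b′ d′
        where
        swap₁ : ∀ a b d → (a + b) + d ≈ (a + d) + b
        swap₁ = solve 3 (λ a b d → (a :+ b) :+ d := (a :+ d) :+ b) refl

    N : V → V
    N x = fold x T (suc n)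

    N-linear : IsLinear N
    N-linear = record
      { F-cong = F-cong
      ; F-+    = F-+
      ; F-·    = λ k x → transᵥ (F-· k x) (·-cong (period k) reflᵥ)
      }
      where open IsSemilinear (fold-semilinear (suc n))

    det-N : ∀ x y → det (N x) (N y) ≈ det x y
    det-N x y = trans (det-fold (suc n) x y) (period _)

    N-T : ∀ x → N (T x) ≡ T (N x)
    N-T = fold-comm (suc n)

    -- If N were the identity, the orbit sums would be fixed by T, hence zero by anisotropy.
    N≉id : ¬ (∀ x → N x ≈ᵥ x)
    N≉id N≈id = 1≉0 (independence n (λ _ → 1#) minimal λ x →
      anisotropic (trans (det-congˡ (fixed x)) (det-alternating (orbitSum n x))))
      where
      cancel : ∀ {x y} z → x +ᵥ z ≈ᵥ y +ᵥ z → x ≈ᵥ y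
      cancel (c , d) (p , q) = cancel₁ c p , cancel₁ d q
        where
        cancel₁ : ∀ {a b} c → a + c ≈ b + c → a ≈ b
        cancel₁ {a} {b} c eq = begin
          a            ≈⟨ solve 2 (λ a c → a := (a :+ c) :+ c) refl a c ⟩
          (a + c) + c  ≈⟨ +-congʳ eq ⟩
          (b + c) + c  ≈⟨ solve 2 (λ a c → (a :+ c) :+ c := a) refl b c ⟩
          b            ∎
          where open ≈-Reasoning
      fixed : ∀ x → T (orbitSum n x) ≈ᵥ orbitSum n x
      fixed x = cancel x (transᵥ (T-orbitSum n x) (+ᵥ-cong reflᵥ (N≈id x)))

    N-cyclic : ∃[ x ] ¬ det x (N x) ≈ 0#
    N-cyclic with cyclic⊎scalar _≟_ N-linear
    ... | inj₁ cyclic       = cyclic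
    ... | inj₂ (k , scalar) = contradiction (λ x → transᵥ (scalar x) (transᵥ (·-cong k≈1 reflᵥ) (1·x≈x x))) N≉id
      where
      open ≈-Reasoning
      k+1² : (k + 1#) * (k + 1#) ≈ 0#
      k+1² = begin
        (k + 1#) * (k + 1#)                    ≈⟨ solve 1 (λ k → (k :+ con true) :* (k :+ con true)
                                                    := ((k :* con true) :* (k :* con true) :+ (k :* con false) :* (k :* con false)) :+ con true) refl k ⟩
        det (k · e₁) (k · e₂) + 1#             ≈⟨ +-congʳ (det-cong (scalar e₁) (scalar e₂)) ⟨
        det (N e₁) (N e₂) + 1#                 ≈⟨ +-congʳ (det-N e₁ e₂) ⟩
        det e₁ e₂ + 1#                         ≈⟨ solve 0 ((con true :* con true :+ con false :* con false) :+ con true := con false) refl ⟩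
        0#                                     ∎
      k≈1 : k ≈ 1#
      k≈1 = x+y≈0⇒x≈y (decidable-stable ((k + 1#) ≟ 0#) λ k+1≉0 → x*y≉0 k+1≉0 k+1≉0 k+1²)

    T-commutant : ∀ {A} → IsLinear A → (∀ x → A (T x) ≈ᵥ T (A x)) →
      ∃₂ λ α β → σ α ≈ α × σ β ≈ β × (∀ x → A x ≈ᵥ α · x +ᵥ β · N x)
    T-commutant {A} A-lin AT≈TA =
      let x , det≉0       = N-cyclic
          α , β , A≈      = cyclic-commutant N-lin A-lin det≉0 (AN≈NA (suc n))
          -- Both sides of T A = A T are expanded at x in terms of T x and T (N x). These are
          -- independent, their determinant being σ of det(x, N x), so coefficients can be compared.
          σα≈α , σβ≈β     = coefficients (subst≉0 x det≉0) (begin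
            σ α · T x +ᵥ σ β · T (N x)      ≈⟨ +ᵥ-cong (T-· α x) (T-· β (N x)) ⟨
            T (α · x) +ᵥ T (β · N x)        ≈⟨ T-+ _ _ ⟨
            T (α · x +ᵥ β · N x)            ≈⟨ T-cong (A≈ x) ⟨
            T (A x)                         ≈⟨ AT≈TA x ⟨
            A (T x)                         ≈⟨ A≈ (T x) ⟩
            α · T x +ᵥ β · N (T x)          ≡⟨ ≡.cong (λ y → α · T x +ᵥ β · y) (N-T x) ⟩
            α · T x +ᵥ β · T (N x)          ∎)
      in α , β , σα≈α , σβ≈β , A≈
      where
      open ≈ᵥ-Reasoning
      N-lin = N-linear
      AN≈NA : ∀ i x → A (fold x T i) ≈ᵥ fold (A x) T i
      AN≈NA zero    x = reflᵥ
      AN≈NA (suc i) x = transᵥ (AT≈TA _) (T-cong (AN≈NA i x))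
      subst≉0 : ∀ x → ¬ det x (N x) ≈ 0# → ¬ det (T x) (T (N x)) ≈ 0#
      subst≉0 x det≉0 eq = σ-≉0 det≉0 (trans (sym (det-T x (N x))) eq)
      coefficients : ∀ {x y α β γ δ} → ¬ det x y ≈ 0# →
        α · x +ᵥ β · y ≈ᵥ γ · x +ᵥ δ · y → α ≈ γ × β ≈ δ
      coefficients {x} {y} {α} {β} {γ} {δ} det≉0 eq =
          *-cancelˡ det≉0 (trans (sym (onˡ α β)) (trans (det-congʳ eq) (onˡ γ δ)))
        , *-cancelˡ det≉0 (trans (sym (onʳ α β)) (trans (det-congˡ eq) (onʳ γ δ)))
        where
        onˡ : ∀ α β → det (α · x +ᵥ β · y) y ≈ det x y * α
        onˡ α β = trans (det-+ˡ _ _ y) (trans (+-cong (det-·ˡ α x y) (trans (det-·ˡ β y y) (*-congˡ (det-alternating y))))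
          (solve 3 (λ α β d → α :* d :+ β :* con false := d :* α) refl α β (det x y)))
        onʳ : ∀ α β → det x (α · x +ᵥ β · y) ≈ det x y * β
        onʳ α β = trans (det-+ʳ x _ _) (trans (+-cong (trans (det-·ʳ α x x) (*-congˡ (det-alternating x))) (det-·ʳ β x y))
          (solve 3 (λ α β d → α :* con false :+ β :* d := d :* β) refl α β (det x y)))

    -- The adjugate of the matrix of N with columns `N e₁` and `N e₂`; its determinant is 1, and
    -- signs disappear in characteristic 2.
    N⁻¹ : V → V
    N⁻¹ (x , y) =
      let a , b = N e₁
          c , d = N e₂
      in d * x + c * y , b * x + a * y

    N⁻¹-cong : ∀ {x y} → x ≈ᵥ y → N⁻¹ x ≈ᵥ N⁻¹ y
    N⁻¹-cong (p , q) = +-cong (*-congˡ p) (*-congˡ q) , +-cong (*-congˡ p) (*-congˡ q)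

    N-N⁻¹ : ∀ y → N (N⁻¹ y) ≈ᵥ y
    N-N⁻¹ (x , y) = begin
      N (p , q)                         ≈⟨ IsSemilinear.F-cong N-linear (expand₁ p q , expand₂ p q) ⟩
      N (p · e₁ +ᵥ q · e₂)              ≈⟨ F-combination N-linear p q e₁ e₂ ⟩
      p · N e₁ +ᵥ q · N e₂              ≈⟨ ( solve 6 (λ a b c d x y → (d :* x :+ c :* y) :* a :+ (b :* x :+ a :* y) :* c
                                                := (a :* d :+ b :* c) :* x) refl a b c′ d x y
                                           , solve 6 (λ a b c d x y → (d :* x :+ c :* y) :* b :+ (b :* x :+ a :* y) :* d
                                                := (a :* d :+ b :* c) :* y) refl a b c′ d x y ) ⟩
      det (N e₁) (N e₂) · (x , y)       ≈⟨ ·-cong (trans (det-N e₁ e₂) det-e₁e₂) reflᵥ ⟩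
      1# · (x , y)                      ≈⟨ 1·x≈x (x , y) ⟩
      (x , y)                           ∎
      where
      open ≈ᵥ-Reasoning
      a = proj₁ (N e₁)
      b = proj₂ (N e₁)
      c′ = proj₁ (N e₂)
      d = proj₂ (N e₂)
      p = proj₁ (N⁻¹ (x , y))
      q = proj₂ (N⁻¹ (x , y))
      expand₁ : ∀ p q → p ≈ p * 1# + q * 0#
      expand₁ = solve 2 (λ p q → p := p :* con true :+ q :* con false) refl
      expand₂ : ∀ p q → q ≈ p * 0# + q * 1#
      expand₂ = solve 2 (λ p q → q := p :* con false :+ q :* con true) refl
      det-e₁e₂ : det e₁ e₂ ≈ 1#
      det-e₁e₂ = solve 0 (con true :* con true :+ con false :* con false := con true) refl

-- The multiplication defined by a twist

module TwistedMultiplication {c ℓ} {L : CommutativeRing c ℓ} (isField : IsField L) (1+1≈0 : CharTwo L)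
                             (_≟_ : Decidable (CommutativeRing._≈_ L)) where
  open CommutativeRing L hiding (zero)
  open Field isField
  open CharTwoSolver {L = L} 1+1≈0
  open CharTwoField {L = L} isField 1+1≈0
  open Plane {L = L} isField 1+1≈0
  open Twisted {L = L} isField 1+1≈0 _≟_
  private
    module ≈-Reasoning = SetoidReasoning setoid
    module ≈ᵥ-Reasoning = SetoidReasoning setoidᵥ

  module Multiplication {σ T} (twist : IsTwist σ T) (κ l : Carrier) where
    open IsTwist twist

    infix 5 _⊛_
    _⊛_ : V → V → V
    x ⊛ y = κ * det x (T y) + l * (κ * det y (T x)) , det x y

    ⊛-cong : ∀ {x y z w} → x ≈ᵥ y → z ≈ᵥ w → x ⊛ z ≈ᵥ y ⊛ w
    ⊛-cong p q = +-cong (*-congˡ (det-cong p (T-cong q))) (*-congˡ (*-congˡ (det-cong q (T-cong p)))) , det-cong p q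

    ·-⊛ : ∀ {k} → σ k ≈ k → ∀ x y → k · x ⊛ y ≈ᵥ k · (x ⊛ y)
    ·-⊛ {k} σk≈k x y =
        trans (+-cong (*-congˡ (det-·ˡ k x (T y)))
                      (*-congˡ (*-congˡ (trans (det-congˡ (transᵥ (T-· k x) (·-cong σk≈k reflᵥ))) (det-·ʳ k y (T x))))))
          (solve 5 (λ k κ l d e → κ :* (k :* d) :+ l :* (κ :* (k :* e)) := k :* (κ :* d :+ l :* (κ :* e)))
            refl k κ l (det x (T y)) (det y (T x)))
      , det-·ˡ k x y

    ⊛-· : ∀ {k} → σ k ≈ k → ∀ x y → x ⊛ k · y ≈ᵥ k · (x ⊛ y)
    ⊛-· {k} σk≈k x y =
        trans (+-cong (*-congˡ (trans (det-congˡ (transᵥ (T-· k y) (·-cong σk≈k reflᵥ))) (det-·ʳ k x (T y))))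
                      (*-congˡ (*-congˡ (det-·ˡ k y (T x)))))
          (solve 5 (λ k κ l d e → κ :* (k :* d) :+ l :* (κ :* (k :* e)) := k :* (κ :* d :+ l :* (κ :* e)))
            refl k κ l (det x (T y)) (det y (T x)))
      , det-·ʳ k x y

    module Nuclei (κ≉0 : ¬ κ ≈ 0#) (l≉0 : ¬ l ≈ 0#) {μ} (σμ≉μ : ¬ σ μ ≈ μ) where

      module _ {A B : V → V} (A-cong : ∀ {x y} → x ≈ᵥ y → A x ≈ᵥ A y)
               (adjoint : ∀ x y → A x ⊛ y ≈ᵥ x ⊛ B y) where
        private
          det-AB : ∀ x y → det (A x) y ≈ det x (B y)
          det-AB x y = proj₂ (adjoint x y)

        middle-linear : IsLinear A
        middle-linear = record
          { F-cong = A-cong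
          ; F-+    = λ x y → det-nondegenerate λ z → begin
              det (A (x +ᵥ y)) z             ≈⟨ det-AB _ z ⟩
              det (x +ᵥ y) (B z)             ≈⟨ det-+ˡ x y (B z) ⟩
              det x (B z) + det y (B z)      ≈⟨ +-cong (det-AB x z) (det-AB y z) ⟨
              det (A x) z + det (A y) z      ≈⟨ det-+ˡ (A x) (A y) z ⟨
              det (A x +ᵥ A y) z             ∎
          ; F-·    = λ k x → det-nondegenerate λ z → begin
              det (A (k · x)) z              ≈⟨ det-AB _ z ⟩
              det (k · x) (B z)              ≈⟨ det-·ˡ k x (B z) ⟩
              k * det x (B z)                ≈⟨ *-congˡ (det-AB x z) ⟨
              k * det (A x) z                ≈⟨ det-·ˡ k (A x) z ⟨
              det (k · A x) z                ∎
          }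
          where open ≈-Reasoning

        private
          open IsSemilinear middle-linear using () renaming (F-· to A-·)

          -- Paired with a test vector, these measure how far `B` and `A` are from commuting with T.
          P Q : V → V → Carrier
          P x y = det x (B (T y)) + det x (T (B y))
          Q x y = det y (A (T x)) + det y (T (A x))

          -- The first coordinate of `adjoint`, after its second coordinate has carried `A` and `B`
          -- across `det`. The term l κ det(y, T (A x)) is inserted twice, which adds nothing in
          -- characteristic 2.
          balance : ∀ x y → κ * P x y ≈ (l * κ) * Q x y
          balance x y = begin
            κ * P x y
              ≈⟨ *-congˡ (+-congʳ (det-AB x (T y))) ⟨
            κ * (det (A x) (T y) + det x (T (B y)))
              ≈⟨ solve 5 (λ κ l p q r → κ :* (p :+ q) := (κ :* p :+ l :* (κ :* r)) :+ (κ :* q :+ l :* (κ :* r)))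
                   refl κ l (det (A x) (T y)) (det x (T (B y))) (det y (T (A x))) ⟩
            (κ * det (A x) (T y) + l * (κ * det y (T (A x))))
              + (κ * det x (T (B y)) + l * (κ * det y (T (A x))))
              ≈⟨ +-congʳ (proj₁ (adjoint x y)) ⟩
            (κ * det x (T (B y)) + l * (κ * det (B y) (T x)))
              + (κ * det x (T (B y)) + l * (κ * det y (T (A x))))
              ≈⟨ +-congʳ (+-congˡ (*-congˡ (*-congˡ (trans (det-comm (B y) (T x))
                   (trans (sym (det-AB (T x) y)) (det-comm (A (T x)) y)))))) ⟩
            (κ * det x (T (B y)) + l * (κ * det y (A (T x))))
              + (κ * det x (T (B y)) + l * (κ * det y (T (A x))))
              ≈⟨ solve 5 (λ κ l q r s → (κ :* q :+ l :* (κ :* r)) :+ (κ :* q :+ l :* (κ :* s)) := l :* κ :* (r :+ s))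
                   refl κ l (det x (T (B y))) (det y (A (T x))) (det y (T (A x))) ⟩
            (l * κ) * Q x y ∎
            where open ≈-Reasoning

          P-· : ∀ k x y → P (k · x) y ≈ k * P x y
          P-· k x y = trans (+-cong (det-·ˡ k x _) (det-·ˡ k x _)) (sym (distribˡ k _ _))

          Q-· : ∀ k x y → Q (k · x) y ≈ σ k * Q x y
          Q-· k x y = trans
            (+-cong (trans (det-congˡ (transᵥ (A-cong (T-· k x)) (A-· (σ k) (T x)))) (det-·ʳ (σ k) y _))
                    (trans (det-congˡ (transᵥ (T-cong (A-· k x)) (T-· k (A x)))) (det-·ʳ (σ k) y _)))
            (sym (distribˡ (σ k) _ _))

          -- Adding μ times `balance` at x to `balance` at μ · x cancels the `P` terms and leaves l
          -- κ (σ μ + μ) Q.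
          Q≈0 : ∀ x y → Q x y ≈ 0#
          Q≈0 x y = x*y≈0⇒y≈0 (x*y≉0 (x*y≉0 l≉0 κ≉0) (λ eq → σμ≉μ (x+y≈0⇒x≈y eq))) (begin
            l * κ * (σ μ + μ) * Q x y                   ≈⟨ solve 4 (λ m s μ q → m :* (s :+ μ) :* q := m :* (s :* q) :+ μ :* (m :* q))
                                                             refl (l * κ) (σ μ) μ (Q x y) ⟩
            l * κ * (σ μ * Q x y) + μ * (l * κ * Q x y) ≈⟨ +-cong (*-congˡ (Q-· μ x y)) (*-congˡ (balance x y)) ⟨
            l * κ * Q (μ · x) y + μ * (κ * P x y)       ≈⟨ +-congʳ (balance (μ · x) y) ⟨
            κ * P (μ · x) y + μ * (κ * P x y)           ≈⟨ +-congʳ (*-congˡ (P-· μ x y)) ⟩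
            κ * (μ * P x y) + μ * (κ * P x y)           ≈⟨ solve 3 (λ κ μ p → κ :* (μ :* p) :+ μ :* (κ :* p) := con false) refl κ μ (P x y) ⟩
            0#                                          ∎)
            where open ≈-Reasoning

        -- For fixed y the first coordinate is a sum of an L-linear and a σ-semilinear
        -- function of x, and these parts separate because σ moves μ.
        middle-commutes : ∀ x → A (T x) ≈ᵥ T (A x)
        middle-commutes x = x+y≈0⇒x≈y-ᵥ (det≈0⇒≈0ᵥ λ y →
          trans (det-comm _ y) (trans (det-+ʳ y _ _) (Q≈0 x y)))

      module Central (l-nonpower : ∀ {k} → σ k ≈ l * k → k ≈ 0#)
                     (surjective : ∀ y → ∃[ k ] σ k + l * k ≈ y) where

        -- Parallel vectors have determinant 0, so this product and the one in `multiple` differ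
        -- only in the factor beside κ det(x, T x). Matching these factors makes the products equal,
        -- whatever `C` is.
        square : ∀ x → μ · x ⊛ μ · x ≈ᵥ (κ * det x (T x) * (μ * σ μ * (1# + l)) , 0#)
        square x =
            trans (+-cong (*-congˡ both) (*-congˡ (*-congˡ both)))
              (solve 5 (λ κ l μ s d → κ :* (μ :* (s :* d)) :+ l :* (κ :* (μ :* (s :* d)))
                 := κ :* d :* (μ :* s :* (con true :+ l))) refl κ l μ (σ μ) (det x (T x)))
          , det-alternating (μ · x)
          where
          both : det (μ · x) (T (μ · x)) ≈ μ * (σ μ * det x (T x))
          both = trans (det-·ˡ μ x _) (*-congˡ (trans (det-congˡ (T-· μ x)) (det-·ʳ (σ μ) x (T x))))

        multiple : ∀ k x → x ⊛ k · x ≈ᵥ (κ * det x (T x) * (σ k + l * k) , 0#)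
        multiple k x =
            trans (+-cong (*-congˡ (trans (det-congˡ (T-· k x)) (det-·ʳ (σ k) x (T x))))
                          (*-congˡ (*-congˡ (det-·ˡ k x (T x)))))
              (solve 5 (λ κ l k s d → κ :* (s :* d) :+ l :* (κ :* (k :* d)) := κ :* d :* (s :+ l :* k))
                 refl κ l k (σ k) (det x (T x)))
          , trans (det-·ʳ k x x) (trans (*-congˡ (det-alternating x)) (zeroʳ k))

        -- With k such that σ k + l k = μ σ(μ) (1 + l), the products (μ x) ∘ (μ x) and x ∘ (k x)
        -- agree; applying C shows k = μ², and hence σ μ = l μ.
        central-scalar : ∀ {A C : V → V} → IsLinear A → (∀ {x y} → x ≈ᵥ y → C x ≈ᵥ C y) →
          (∀ x y → A x ⊛ y ≈ᵥ C (x ⊛ y)) → ∀ x → det x (A x) ≈ 0#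
        central-scalar {A} {C} A-lin C-cong central x = decidable-stable (det x (A x) ≟ 0#) λ det≉0 →
          let k , k-eq = surjective (μ * σ μ * (1# + l))
              same : μ · x ⊛ μ · x ≈ᵥ x ⊛ k · x
              same = let open ≈ᵥ-Reasoning in begin
                μ · x ⊛ μ · x                                    ≈⟨ square x ⟩
                (κ * det x (T x) * (μ * σ μ * (1# + l)) , 0#)    ≈⟨ (*-congˡ k-eq , refl) ⟨
                (κ * det x (T x) * (σ k + l * k) , 0#)           ≈⟨ multiple k x ⟨
                x ⊛ k · x                                        ∎
              μμ≈k : μ * μ ≈ k
              μμ≈k = *-cancelˡ (λ eq → det≉0 (trans (det-comm x (A x)) eq)) (let open ≈-Reasoning in begin
                det (A x) x * (μ * μ)      ≈⟨ solve 2 (λ d μ → d :* (μ :* μ) := μ :* (μ :* d)) refl _ μ ⟩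
                μ * (μ * det (A x) x)      ≈⟨ *-congˡ (det-·ˡ μ (A x) x) ⟨
                μ * det (μ · A x) x        ≈⟨ *-congˡ (det-congʳ (A-· μ x)) ⟨
                μ * det (A (μ · x)) x      ≈⟨ det-·ʳ μ _ x ⟨
                det (A (μ · x)) (μ · x)    ≈⟨ proj₂ (central (μ · x) (μ · x)) ⟩
                proj₂ (C (μ · x ⊛ μ · x))  ≈⟨ proj₂ (C-cong {μ · x ⊛ μ · x} {x ⊛ k · x} same) ⟩
                proj₂ (C (x ⊛ k · x))      ≈⟨ proj₂ (central x (k · x)) ⟨
                det (A x) (k · x)          ≈⟨ det-·ʳ k (A x) x ⟩
                k * det (A x) x            ≈⟨ *-comm k _ ⟩
                det (A x) x * k            ∎)
              -- Applying σ to μ² = k turns the equation that defines k into a quadratic relation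
              -- between σ μ and μ, which factors as (σ μ + μ)(σ μ + l μ) = 0.
              σμ≈lμ : σ μ ≈ l * μ
              σμ≈lμ = x+y≈0⇒x≈y (x*y≈0⇒y≈0 (λ eq → σμ≉μ (x+y≈0⇒x≈y eq)) (let open ≈-Reasoning in begin
                (σ μ + μ) * (σ μ + l * μ)
                  ≈⟨ solve 3 (λ s μ l → (s :+ μ) :* (s :+ l :* μ)
                       := (s :* s :+ l :* (μ :* μ)) :+ μ :* s :* (con true :+ l)) refl (σ μ) μ l ⟩
                (σ μ * σ μ + l * (μ * μ)) + μ * σ μ * (1# + l)
                  ≈⟨ +-congʳ (+-cong (trans (sym (σ-* μ μ)) (σ-cong μμ≈k)) (*-congˡ μμ≈k)) ⟩
                (σ k + l * k) + μ * σ μ * (1# + l)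
                  ≈⟨ x≈y⇒x+y≈0 k-eq ⟩
                0# ∎))
              μ≈0 = l-nonpower σμ≈lμ
          in σμ≉μ (trans (σ-cong μ≈0) (trans σ-0 (sym μ≈0)))
          where open IsSemilinear A-lin using () renaming (F-· to A-·)

    module Autotopy {n} (order : HasOrder σ n) where
      open Powers twist order

      -- The product is built from `det` and T alone; N preserves the one and commutes with the
      -- other.
      N-isometry : ∀ x y → N x ⊛ N y ≈ᵥ x ⊛ y
      N-isometry x y = +-cong (*-congˡ (det-NT x y)) (*-congˡ (*-congˡ (det-NT y x))) , det-N x y
        where
        det-NT : ∀ x y → det (N x) (T (N y)) ≈ det x (T y)
        det-NT x y = trans (reflexive (≡.cong (det (N x)) (≡.sym (N-T y)))) (det-N x (T y))

      N-middle : ∀ x y → N x ⊛ y ≈ᵥ x ⊛ N⁻¹ y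
      N-middle x y = transᵥ (⊛-cong reflᵥ (symᵥ (N-N⁻¹ y))) (N-isometry x (N⁻¹ y))

-- Nuclei of semifields

module SemifieldNuclei {c ℓ} {S : NonAssociativeRing c ℓ} (isSemifield : IsSemifield S) where
  open NonAssociativeRing S
  open IsSemifield isSemifield
  open Finite setoid (proj₂ finite)
  open GroupProperties +-group using (inverseʳ-unique; x∙y⁻¹≈ε⇒x≈y)
  open SetoidReasoning setoid

  -‿distribˡ-* : ∀ x y → (- x) * y ≈ - (x * y)
  -‿distribˡ-* x y = inverseʳ-unique (x * y) (- x * y) (begin
    x * y + - x * y      ≈⟨ distribʳ y x (- x) ⟨
    (x + - x) * y        ≈⟨ *-congʳ (-‿inverseʳ x) ⟩
    0# * y               ≈⟨ zeroˡ y ⟩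
    0#                   ∎)

  -‿distribʳ-* : ∀ x y → x * (- y) ≈ - (x * y)
  -‿distribʳ-* x y = inverseʳ-unique (x * y) (x * - y) (begin
    x * y + x * - y      ≈⟨ distribˡ x y (- y) ⟨
    x * (y + - y)        ≈⟨ *-congˡ (-‿inverseʳ y) ⟩
    x * 0#               ≈⟨ zeroʳ x ⟩
    0#                   ∎)

  *-cancelˡ : ∀ {u} → ¬ u ≈ 0# → Injective _≈_ _≈_ (u *_)
  *-cancelˡ {u} u≉0 {x} {y} eq with noZeroDivisors u (x + - y) (begin
    u * (x + - y)        ≈⟨ distribˡ u x (- y) ⟩
    u * x + u * - y      ≈⟨ +-cong eq (-‿distribʳ-* u y) ⟩
    u * y + - (u * y)    ≈⟨ -‿inverseʳ (u * y) ⟩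
    0#                   ∎)
  ... | inj₁ u≈0   = contradiction u≈0 u≉0
  ... | inj₂ x-y≈0 = x∙y⁻¹≈ε⇒x≈y x y x-y≈0

  *-cancelʳ : ∀ {u} → ¬ u ≈ 0# → Injective _≈_ _≈_ (_* u)
  *-cancelʳ {u} u≉0 {x} {y} eq with noZeroDivisors (x + - y) u (begin
    (x + - y) * u        ≈⟨ distribʳ u x (- y) ⟩
    x * u + - y * u      ≈⟨ +-cong eq (-‿distribˡ-* y u) ⟩
    y * u + - (y * u)    ≈⟨ -‿inverseʳ (y * u) ⟩
    0#                   ∎)
  ... | inj₁ x-y≈0 = x∙y⁻¹≈ε⇒x≈y x y x-y≈0
  ... | inj₂ u≈0   = contradiction u≈0 u≉0

  -- `A` plays right multiplication by a middle-nuclear u, and `B` left multiplication. As `A` and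
  -- `B` always arise in this way from u = A 1, closure properties of the nucleus reduce to
  -- exhibiting pairs.
  Adjoint : (A B : Carrier → Carrier) → Set (c ⊔ ℓ)
  Adjoint A B = ∀ x y → A x * y ≈ x * B y

  adjoint-at-1 : ∀ {A B} → Adjoint A B → B 1# ≈ A 1#
  adjoint-at-1 {A} {B} adj = trans (sym (*-identityˡ _)) (trans (sym (adj 1# 1#)) (*-identityʳ _))

  adjoint-multiplication : ∀ {A B} → Adjoint A B → ∀ x → A x ≈ x * A 1#
  adjoint-multiplication {A} {B} adj x = begin
    A x          ≈⟨ *-identityʳ (A x) ⟨
    A x * 1#     ≈⟨ adj x 1# ⟩
    x * B 1#     ≈⟨ *-congˡ (adjoint-at-1 adj) ⟩
    x * A 1#     ∎

  middle-resp : ∀ {u v} → u ≈ v → u ∈ MiddleNucleus S → v ∈ MiddleNucleus S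
  middle-resp u≈v mid y w = trans (*-congˡ (*-congʳ (sym u≈v))) (trans (mid y w) (*-congʳ (*-congˡ u≈v)))

  adjoint⇒middle : ∀ {A B} → Adjoint A B → A 1# ∈ MiddleNucleus S
  adjoint⇒middle {A} {B} adj y w = begin
    y * (A 1# * w)     ≈⟨ *-congˡ (trans (adj 1# w) (*-identityˡ (B w))) ⟩
    y * B w            ≈⟨ adj y w ⟨
    A y * w            ≈⟨ *-congʳ (adjoint-multiplication adj y) ⟩
    (y * A 1#) * w     ∎

  -- The counterpart for the center, where all three maps are multiplication by one central element.
  -- Only `C` is asked to respect equality, since `A` and `B` agree with it pointwise.
  record Homothety (A B C : Carrier → Carrier) : Set (c ⊔ ℓ) where
    field
      C-cong : Congruent _≈_ _≈_ C
      left   : ∀ x y → A x * y ≈ C (x * y)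
      right  : ∀ x y → x * B y ≈ C (x * y)

  center-resp : ∀ {u v} → u ≈ v → u ∈ Center S → v ∈ Center S
  center-resp u≈v (lft , mid , rgt , comm) =
      (λ y w → trans (*-congʳ (sym u≈v)) (trans (lft y w) (*-congʳ (*-congʳ u≈v))))
    , middle-resp u≈v mid
    , (λ y w → trans (*-congˡ (*-congˡ (sym u≈v))) (trans (rgt y w) (*-congˡ u≈v)))
    , (λ y → trans (*-congʳ (sym u≈v)) (trans (comm y) (*-congˡ u≈v)))

  -- Setting y = 1 gives A = C and setting x = 1 gives B = C. So C slides freely through products
  -- and is multiplication by C 1 on either side.
  homothety⇒center : ∀ {A B C} → Homothety A B C → A 1# ∈ Center S
  homothety⇒center {A} {B} {C} hom = center-resp (sym (A≈C 1#))
    ( (λ y w → begin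
        C 1# * (y * w)     ≈⟨ C1* (y * w) ⟩
        C (y * w)          ≈⟨ C-left y w ⟨
        C y * w            ≈⟨ *-congʳ (C1* y) ⟨
        (C 1# * y) * w     ∎)
    , (λ y w → begin
        y * (C 1# * w)     ≈⟨ *-congˡ (C1* w) ⟩
        y * C w            ≈⟨ C-right y w ⟩
        C (y * w)          ≈⟨ C-left y w ⟨
        C y * w            ≈⟨ *-congʳ (*C1 y) ⟨
        (y * C 1#) * w     ∎)
    , (λ y w → begin
        y * (w * C 1#)     ≈⟨ *-congˡ (*C1 w) ⟩
        y * C w            ≈⟨ C-right y w ⟩
        C (y * w)          ≈⟨ *C1 (y * w) ⟨
        (y * w) * C 1#     ∎)
    , (λ y → trans (C1* y) (sym (*C1 y))) )
    where
    open Homothety hom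
    A≈C : ∀ x → A x ≈ C x
    A≈C x = trans (sym (*-identityʳ _)) (trans (left x 1#) (C-cong (*-identityʳ x)))
    B≈C : ∀ x → B x ≈ C x
    B≈C x = trans (sym (*-identityˡ _)) (trans (right 1# x) (C-cong (*-identityˡ x)))
    C-left : ∀ x y → C x * y ≈ C (x * y)
    C-left x y = trans (*-congʳ (sym (A≈C x))) (left x y)
    C-right : ∀ x y → x * C y ≈ C (x * y)
    C-right x y = trans (*-congˡ (sym (B≈C y))) (right x y)
    C1* : ∀ x → C 1# * x ≈ C x
    C1* x = trans (C-left 1# x) (C-cong (*-identityˡ x))
    *C1 : ∀ x → x * C 1# ≈ C x
    *C1 x = trans (C-right x 1#) (C-cong (*-identityʳ x))

  homothety-multiplication : ∀ {A B C} → Homothety A B C → ∀ x → A x ≈ A 1# * x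
  homothety-multiplication {A} {B} {C} hom x = begin
    A x              ≈⟨ *-identityʳ (A x) ⟨
    A x * 1#         ≈⟨ left x 1# ⟩
    C (x * 1#)       ≈⟨ C-cong (trans (*-identityʳ x) (sym (*-identityˡ x))) ⟩
    C (1# * x)       ≈⟨ left 1# x ⟨
    A 1# * x         ∎
    where open Homothety hom

  center⇒homothety : ∀ {u} → u ∈ Center S → Homothety (u *_) (u *_) (u *_)
  center⇒homothety {u} (lft , mid , rgt , comm) = record
    { C-cong = *-congˡ
    ; left   = λ x y → sym (lft x y)
    ; right  = λ x y → trans (mid x y) (trans (*-congʳ (sym (comm x))) (sym (lft x y)))
    }

  center⊆middle : Center S ⊆ MiddleNucleus S
  center⊆middle (_ , mid , _) = mid

  module _ (1≉0 : ¬ 1# ≈ 0#) where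

    middle-isSubfield :
      (∀ {x y} → x ∈ MiddleNucleus S → y ∈ MiddleNucleus S → x * y ≈ y * x) →
      IsSubfield S (MiddleNucleus S)
    middle-isSubfield comm = record
      { resp-≈     = middle-resp
      ; 0-closed   = adjoint⇒middle {λ _ → 0#} {λ _ → 0#} (λ x y → trans (zeroˡ y) (sym (zeroʳ x)))
      ; 1-closed   = adjoint⇒middle {id} {id} (λ x y → refl)
      ; +-closed   = λ {u} {v} u∈ v∈ → middle-resp (+-cong (*-identityˡ u) (*-identityˡ v))
          (adjoint⇒middle {λ x → x * u + x * v} {λ x → u * x + v * x} λ x y →
            trans (distribʳ y (x * u) (x * v)) (trans (+-cong (sym (u∈ x y)) (sym (v∈ x y)))
              (sym (distribˡ x (u * y) (v * y)))))
      ; neg-closed = λ {u} u∈ → middle-resp (-‿cong (*-identityˡ u))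
          (adjoint⇒middle {λ x → - (x * u)} {λ x → - (u * x)} λ x y →
            trans (-‿distribˡ-* (x * u) y) (trans (-‿cong (sym (u∈ x y))) (sym (-‿distribʳ-* x (u * y)))))
      ; *-closed   = λ {u} {v} u∈ v∈ → middle-resp (*-congʳ (*-identityˡ u))
          (adjoint⇒middle {λ x → (x * u) * v} {λ x → u * (v * x)} λ x y →
            trans (sym (v∈ (x * u) y)) (sym (u∈ x (v * y))))
      ; *-assoc    = λ {x} {y} {z} _ y∈ _ → sym (y∈ x z)
      ; *-comm     = comm
      ; 1≉0        = 1≉0
      ; inverse    = λ {u} u∈ u≉0 →
          let divideˡ = injective⇒strictlySurjective (*-cancelˡ u≉0)
              divideʳ = injective⇒strictlySurjective (*-cancelʳ u≉0)
              L⁻¹ = λ x → proj₁ (divideˡ x)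
              R⁻¹ = λ x → proj₁ (divideʳ x)
              -- Dividing by u on the right and on the left is again an adjoint pair, which puts the
              -- inverse of u in the nucleus.
              adj : Adjoint R⁻¹ L⁻¹
              adj x y = begin
                R⁻¹ x * y                ≈⟨ *-congˡ (proj₂ (divideˡ y)) ⟨
                R⁻¹ x * (u * L⁻¹ y)      ≈⟨ u∈ _ _ ⟩
                (R⁻¹ x * u) * L⁻¹ y      ≈⟨ *-congʳ (proj₂ (divideʳ x)) ⟩
                x * L⁻¹ y                ∎
          in R⁻¹ 1# , adjoint⇒middle adj , (begin
            u * R⁻¹ 1#     ≈⟨ *-congˡ (adjoint-at-1 adj) ⟨
            u * L⁻¹ 1#     ≈⟨ proj₂ (divideˡ 1#) ⟩
            1#             ∎)
      }

    center-isSubfield : IsSubfield S (Center S)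
    center-isSubfield = record
      { resp-≈     = center-resp
      ; 0-closed   = homothety⇒center {λ _ → 0#} {λ _ → 0#} {λ _ → 0#} record
          { C-cong = λ _ → refl ; left = λ x y → zeroˡ y ; right = λ x y → zeroʳ x }
      ; 1-closed   = homothety⇒center {id} {id} {id} record
          { C-cong = id ; left = λ x y → refl ; right = λ x y → refl }
      ; +-closed   = λ {u} {v} u∈ v∈ →
          let module U = Homothety (center⇒homothety u∈)
              module V = Homothety (center⇒homothety v∈)
              C = λ x → u * x + v * x
          in center-resp (+-cong (*-identityʳ u) (*-identityʳ v)) (homothety⇒center {C} {C} {C} record
            { C-cong = λ eq → +-cong (*-congˡ eq) (*-congˡ eq)
            ; left   = λ x y → trans (distribʳ y (u * x) (v * x)) (+-cong (U.left x y) (V.left x y))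
            ; right  = λ x y → trans (distribˡ x (u * y) (v * y)) (+-cong (U.right x y) (V.right x y))
            })
      ; neg-closed = λ {u} u∈ →
          let module U = Homothety (center⇒homothety u∈)
              C = λ x → - (u * x)
          in center-resp (-‿cong (*-identityʳ u)) (homothety⇒center {C} {C} {C} record
            { C-cong = λ eq → -‿cong (*-congˡ eq)
            ; left   = λ x y → trans (-‿distribˡ-* (u * x) y) (-‿cong (U.left x y))
            ; right  = λ x y → trans (-‿distribʳ-* x (u * y)) (-‿cong (U.right x y))
            })
      ; *-closed   = λ {u} {v} u∈ v∈ →
          let module U = Homothety (center⇒homothety u∈)
              module V = Homothety (center⇒homothety v∈)
              C = λ x → u * (v * x)
          in center-resp (*-congˡ (*-identityʳ v)) (homothety⇒center {C} {C} {C} record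
            { C-cong = λ eq → *-congˡ (*-congˡ eq)
            ; left   = λ x y → trans (U.left (v * x) y) (*-congˡ (V.left x y))
            ; right  = λ x y → trans (U.right x (v * y)) (*-congˡ (V.right x y))
            })
      ; *-assoc    = λ {x} {y} {z} x∈ _ _ → sym (proj₁ x∈ y z)
      ; *-comm     = λ {x} {y} x∈ _ → proj₂ (proj₂ (proj₂ x∈)) y
      ; 1≉0        = 1≉0
      ; inverse    = λ {u} u∈ u≉0 →
          let module U = Homothety (center⇒homothety u∈)
              cancel  = *-cancelˡ u≉0
              divide  = injective⇒strictlySurjective cancel
              C       = λ x → proj₁ (divide x)
              u*C     = λ x → proj₂ (divide x)
          in C 1# , homothety⇒center {C} {C} {C} record
            { C-cong = λ {x} {y} eq → cancel (trans (u*C x) (trans eq (sym (u*C y))))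
            ; left   = λ x y → cancel (trans (sym (U.left (C x) y)) (trans (*-congʳ (u*C x)) (sym (u*C (x * y)))))
            ; right  = λ x y → cancel (trans (sym (U.right x (C y))) (trans (*-congˡ (u*C y)) (sym (u*C (x * y)))))
            } , u*C 1#
      }

    -- If s ≠ 0, the relation solves to e = -r/s, which is central.
    center-independent : ∀ {e} → e ∉ Center S → ∀ {r s} → r ∈ Center S → s ∈ Center S →
      r * 1# + s * e ≈ 0# → r ≈ 0# × s ≈ 0#
    center-independent {e} e∉ {r} {s} r∈ s∈ eq = r≈0 , s≈0
      where
      open IsSubfield center-isSubfield using (neg-closed; *-closed; inverse; *-comm)
      s≈0 : s ≈ 0#
      s≈0 = decidable-stable (s ≟ 0#) λ s≉0 →
        let w , w∈ , sw≈1 = inverse s∈ s≉0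
        in e∉ (center-resp (begin
          w * - r              ≈⟨ *-congˡ (-‿cong (*-identityʳ r)) ⟨
          w * - (r * 1#)       ≈⟨ *-congˡ (inverseʳ-unique _ _ eq) ⟨
          w * (s * e)          ≈⟨ proj₁ w∈ s e ⟩
          (w * s) * e          ≈⟨ *-congʳ (trans (*-comm w∈ s∈) sw≈1) ⟩
          1# * e               ≈⟨ *-identityˡ e ⟩
          e                    ∎) (*-closed w∈ (neg-closed r∈)))
      r≈0 : r ≈ 0#
      r≈0 = begin
        r                      ≈⟨ *-identityʳ r ⟨
        r * 1#                 ≈⟨ +-identityʳ _ ⟨
        r * 1# + 0#            ≈⟨ +-cong refl (trans (*-congʳ s≈0) (zeroˡ e)) ⟨
        r * 1# + s * e         ≈⟨ eq ⟩
        0#                     ∎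

-- The isotopes of B(2,m,s,l,t)

open import Data.Nat.Base using (_≤_; _<_; _*_; _∸_; _^_)

module LegitimateTwist {c ℓ} {L : CommutativeRing c ℓ} {m} (1≤m : 1 ≤ m) (gf : IsGF (2 ^ m) L)
                       (s : ℕ) {t : Quadruple L} (legitimate : Legitimate L s t) where
  open CommutativeRing L hiding (zero) renaming (_*_ to _*ᴸ_)
  open import Algebra.Properties.CommutativeSemiring.Exp commutativeSemiring
    using (^-congˡ; ^-homo-*; ^-distrib-*) renaming (_^_ to _^ᴸ_)
  open IsGF gf
  open IsField isField
  open Field isField
  open Finite setoid cardinality
  open BinaryField {L = L} 1≤m gf
  open CharTwoSolver {L = L} 1+1≈0
  open CharTwoField {L = L} isField 1+1≈0
  open Plane {L = L} isField 1+1≈0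
  open Twisted {L = L} isField 1+1≈0 _≟_
  open Quadruple t
  private
    module ≈-Reasoning = SetoidReasoning setoid

  σ : Carrier → Carrier
  σ x = x ^ᴸ (2 ^ s)

  private
    p₁≉0 : ¬ p₁ ≈ 0#
    p₁≉0 = proj₁ legitimate

    rootless : ∀ x → ¬ p₁ *ᴸ (σ x *ᴸ x) + p₂ *ᴸ σ x + p₃ *ᴸ x + p₄ ≈ 0#
    rootless x eq = proj₂ legitimate x
      (trans (+-congʳ (+-congʳ (+-congʳ (*-congˡ (trans (^-homo-* x (2 ^ s) 1) (*-congˡ (*-identityʳ x))))))) eq)

    σ-0 : σ 0# ≈ 0#
    σ-0 = begin
      σ 0#            ≈⟨ ^-congˡ (2 ^ s) (+-identityˡ 0#) ⟨
      σ (0# + 0#)     ≈⟨ frobenius-+ s 0# 0# ⟩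
      σ 0# + σ 0#     ≈⟨ x+x≈0 (σ 0#) ⟩
      0#              ∎
      where open ≈-Reasoning

    σ-≉0 : ∀ {x} → ¬ x ≈ 0# → ¬ σ x ≈ 0#
    σ-≉0 {x} x≉0 = power≉0 (2 ^ s)
      where
      power≉0 : ∀ n → ¬ x ^ᴸ n ≈ 0#
      power≉0 zero    = 1≉0
      power≉0 (suc n) = x*y≉0 x≉0 (power≉0 n)

  -- With x = (a , b), det(x, T₀ y) is a times the second coordinate of T₀ y plus b times the first.
  -- Hence `p₁`, `p₃`, the coefficients of a in the product, stand in the second coordinate.
  T₀ : V → V
  T₀ (c , d) = p₂ *ᴸ σ c + p₄ *ᴸ σ d , p₁ *ᴸ σ c + p₃ *ᴸ σ d

  -- det T₀ is p₁ times the value of the polynomial at p₂/p₁.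
  δ : Carrier
  δ = p₁ *ᴸ p₄ + p₂ *ᴸ p₃

  δ≉0 : ¬ δ ≈ 0#
  δ≉0 δ≈0 =
    let i , p₁i≈1 = inverse p₁ p₁≉0
        x         = p₂ *ᴸ i
        p₁x≈p₂    : p₁ *ᴸ x ≈ p₂
        p₁x≈p₂    = trans (solve 3 (λ p q i → p :* (q :* i) := q :* (p :* i)) refl p₁ p₂ i)
                      (trans (*-congˡ p₁i≈1) (*-identityʳ p₂))
    in rootless x (x*y≈0⇒y≈0 p₁≉0 (begin
      p₁ *ᴸ (p₁ *ᴸ (σ x *ᴸ x) + p₂ *ᴸ σ x + p₃ *ᴸ x + p₄)
        ≈⟨ solve 6 (λ p₁ p₂ p₃ p₄ x s → p₁ :* (p₁ :* (s :* x) :+ p₂ :* s :+ p₃ :* x :+ p₄)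
             := p₁ :* s :* (p₁ :* x :+ p₂) :+ (p₃ :* (p₁ :* x) :+ p₁ :* p₄)) refl p₁ p₂ p₃ p₄ x (σ x) ⟩
      p₁ *ᴸ σ x *ᴸ (p₁ *ᴸ x + p₂) + (p₃ *ᴸ (p₁ *ᴸ x) + p₁ *ᴸ p₄)
        ≈⟨ +-cong (*-congˡ (+-congʳ p₁x≈p₂)) (+-congʳ (*-congˡ p₁x≈p₂)) ⟩
      p₁ *ᴸ σ x *ᴸ (p₂ + p₂) + (p₃ *ᴸ p₂ + p₁ *ᴸ p₄)
        ≈⟨ solve 5 (λ p₁ p₂ p₃ p₄ s → p₁ :* s :* (p₂ :+ p₂) :+ (p₃ :* p₂ :+ p₁ :* p₄)
             := p₁ :* p₄ :+ p₂ :* p₃) refl p₁ p₂ p₃ p₄ (σ x) ⟩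
      δ ≈⟨ δ≈0 ⟩
      0# ∎))
    where open ≈-Reasoning

  κ : Carrier
  κ = proj₁ (sqrt δ)

  κκ≈δ : κ *ᴸ κ ≈ δ
  κκ≈δ = proj₂ (sqrt δ)

  κ≉0 : ¬ κ ≈ 0#
  κ≉0 κ≈0 = δ≉0 (trans (sym κκ≈δ) (trans (*-congʳ κ≈0) (zeroˡ κ)))

  κ⁻¹ : Carrier
  κ⁻¹ = proj₁ (inverse κ κ≉0)

  κκ⁻¹≈1 : κ *ᴸ κ⁻¹ ≈ 1#
  κκ⁻¹≈1 = proj₂ (inverse κ κ≉0)

  -- T₀ rescaled to have determinant 1.
  T : V → V
  T x = κ⁻¹ · T₀ x

  κdetT≈detT₀ : ∀ x y → κ *ᴸ det x (T y) ≈ det x (T₀ y)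
  κdetT≈detT₀ x y = begin
    κ *ᴸ det x (κ⁻¹ · T₀ y)        ≈⟨ *-congˡ (det-·ʳ κ⁻¹ x (T₀ y)) ⟩
    κ *ᴸ (κ⁻¹ *ᴸ det x (T₀ y))     ≈⟨ *-assoc κ κ⁻¹ _ ⟨
    κ *ᴸ κ⁻¹ *ᴸ det x (T₀ y)       ≈⟨ *-congʳ κκ⁻¹≈1 ⟩
    1# *ᴸ det x (T₀ y)             ≈⟨ *-identityˡ _ ⟩
    det x (T₀ y)                   ∎
    where open ≈-Reasoning

  private
    T₀-cong : ∀ {x y} → x ≈ᵥ y → T₀ x ≈ᵥ T₀ y
    T₀-cong (p , q) =
        +-cong (*-congˡ (^-congˡ (2 ^ s) p)) (*-congˡ (^-congˡ (2 ^ s) q))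
      , +-cong (*-congˡ (^-congˡ (2 ^ s) p)) (*-congˡ (^-congˡ (2 ^ s) q))

    T₀-+ : ∀ x y → T₀ (x +ᵥ y) ≈ᵥ T₀ x +ᵥ T₀ y
    T₀-+ (a , b) (c , d) = additive p₂ p₄ , additive p₁ p₃
      where
      additive : ∀ p q → p *ᴸ σ (a + c) + q *ᴸ σ (b + d)
                           ≈ (p *ᴸ σ a + q *ᴸ σ b) + (p *ᴸ σ c + q *ᴸ σ d)
      additive p q = trans (+-cong (*-congˡ (frobenius-+ s a c)) (*-congˡ (frobenius-+ s b d)))
        (solve 6 (λ p q a b c d → p :* (a :+ c) :+ q :* (b :+ d) := (p :* a :+ q :* b) :+ (p :* c :+ q :* d))
          refl p q (σ a) (σ b) (σ c) (σ d))

    T₀-· : ∀ k x → T₀ (k · x) ≈ᵥ σ k · T₀ x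
    T₀-· k (a , b) = scale p₂ p₄ , scale p₁ p₃
      where
      scale : ∀ p q → p *ᴸ σ (k *ᴸ a) + q *ᴸ σ (k *ᴸ b) ≈ σ k *ᴸ (p *ᴸ σ a + q *ᴸ σ b)
      scale p q = trans (+-cong (*-congˡ (^-distrib-* k a (2 ^ s))) (*-congˡ (^-distrib-* k b (2 ^ s))))
        (solve 5 (λ p q k a b → p :* (k :* a) :+ q :* (k :* b) := k :* (p :* a :+ q :* b))
          refl p q (σ k) (σ a) (σ b))

    det-T₀ : ∀ x y → det (T₀ x) (T₀ y) ≈ δ *ᴸ σ (det x y)
    det-T₀ (a , b) (c , d) = begin
      det (T₀ (a , b)) (T₀ (c , d))
        ≈⟨ solve 8 (λ p₁ p₂ p₃ p₄ a b c d →
             (p₂ :* a :+ p₄ :* b) :* (p₁ :* c :+ p₃ :* d) :+ (p₁ :* a :+ p₃ :* b) :* (p₂ :* c :+ p₄ :* d)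
               := (p₁ :* p₄ :+ p₂ :* p₃) :* (a :* d :+ b :* c)) refl p₁ p₂ p₃ p₄ (σ a) (σ b) (σ c) (σ d) ⟩
      δ *ᴸ (σ a *ᴸ σ d + σ b *ᴸ σ c)
        ≈⟨ *-congˡ (+-cong (^-distrib-* a d (2 ^ s)) (^-distrib-* b c (2 ^ s))) ⟨
      δ *ᴸ (σ (a *ᴸ d) + σ (b *ᴸ c))
        ≈⟨ *-congˡ (frobenius-+ s (a *ᴸ d) (b *ᴸ c)) ⟨
      δ *ᴸ σ (det (a , b) (c , d)) ∎
      where open ≈-Reasoning

    -- Homogenisation: det(x, T₀ x) = b^(σ+1) p(a/b) for x = (a,b) with b ≠ 0.
    T₀-anisotropic : ∀ x → det x (T₀ x) ≈ 0# → x ≈ᵥ 0ᵥ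
    T₀-anisotropic (a , b) eq = a≈0 , b≈0
      where
      open ≈-Reasoning
      b≈0 : b ≈ 0#
      b≈0 = decidable-stable (b ≟ 0#) λ b≉0 →
        let i , bi≈1 = inverse b b≉0
            x        = a *ᴸ i
            a≈xb     : a ≈ x *ᴸ b
            a≈xb     = trans (sym (*-identityʳ a)) (trans (*-congˡ (sym bi≈1))
                         (solve 3 (λ a b i → a :* (b :* i) := a :* i :* b) refl a b i))
            σa≈      = trans (^-congˡ (2 ^ s) a≈xb) (^-distrib-* x b (2 ^ s))
        in rootless x (x*y≈0⇒y≈0 (x*y≉0 b≉0 (σ-≉0 b≉0)) (begin
          b *ᴸ σ b *ᴸ (p₁ *ᴸ (σ x *ᴸ x) + p₂ *ᴸ σ x + p₃ *ᴸ x + p₄)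
            ≈⟨ solve 8 (λ p₁ p₂ p₃ p₄ x b s t →
                 b :* t :* (p₁ :* (s :* x) :+ p₂ :* s :+ p₃ :* x :+ p₄)
                   := (x :* b) :* (p₁ :* (s :* t) :+ p₃ :* t) :+ b :* (p₂ :* (s :* t) :+ p₄ :* t))
                 refl p₁ p₂ p₃ p₄ x b (σ x) (σ b) ⟩
          (x *ᴸ b) *ᴸ (p₁ *ᴸ (σ x *ᴸ σ b) + p₃ *ᴸ σ b) + b *ᴸ (p₂ *ᴸ (σ x *ᴸ σ b) + p₄ *ᴸ σ b)
            ≈⟨ +-cong (*-cong a≈xb (+-congʳ (*-congˡ σa≈))) (*-congˡ (+-congʳ (*-congˡ σa≈))) ⟨
          det (a , b) (T₀ (a , b))
            ≈⟨ eq ⟩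
          0# ∎))
      σb≈0 : σ b ≈ 0#
      σb≈0 = trans (^-congˡ (2 ^ s) b≈0) σ-0
      -- Once b = 0, the form reduces to its term p₁ a σ(a).
      a≈0 : a ≈ 0#
      a≈0 = decidable-stable (a ≟ 0#) λ a≉0 →
        x*y≉0 p₁≉0 (x*y≉0 a≉0 (σ-≉0 a≉0)) (begin
          p₁ *ᴸ (a *ᴸ σ a)
            ≈⟨ solve 6 (λ p₁ p₃ a s t w → p₁ :* (a :* s)
                 := (a :* (p₁ :* s :+ p₃ :* t) :+ w) :+ (a :* p₃ :* t :+ w)) refl p₁ p₃ a (σ a) (σ b) w ⟩
          det (a , b) (T₀ (a , b)) + (a *ᴸ p₃ *ᴸ σ b + w)
            ≈⟨ +-cong eq (+-cong (trans (*-congˡ σb≈0) (zeroʳ _)) (trans (*-congʳ b≈0) (zeroˡ _))) ⟩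
          0# + (0# + 0#)
            ≈⟨ trans (+-identityˡ _) (+-identityˡ _) ⟩
          0# ∎)
        where w = b *ᴸ (p₂ *ᴸ σ a + p₄ *ᴸ σ b)

  twist : IsTwist σ T
  twist = record
    { σ-homomorphism = record
      { isNearSemiringHomomorphism = record
        { +-isMonoidHomomorphism = record
          { isMagmaHomomorphism = record
            { isRelHomomorphism = record { cong = ^-congˡ (2 ^ s) }
            ; homo = frobenius-+ s
            }
          ; ε-homo = σ-0
          }
        ; *-homo = λ x y → ^-distrib-* x y (2 ^ s)
        }
      ; 1#-homo = 1^n≈1 (2 ^ s)
      }
    ; T-semilinear = record
      { F-cong = λ x≈y → ·-cong refl (T₀-cong x≈y)
      ; F-+    = λ x y → transᵥ (·-cong refl (T₀-+ x y)) (·-+ᵥ κ⁻¹ (T₀ x) (T₀ y))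
      ; F-·    = λ k x → transᵥ (·-cong refl (T₀-· k x)) (·-swap κ⁻¹ (σ k) (T₀ x))
      }
    ; det-T = λ x y → let open ≈-Reasoning in begin
        det (T x) (T y)                               ≈⟨ det-·ˡ κ⁻¹ (T₀ x) (T y) ⟩
        κ⁻¹ *ᴸ det (T₀ x) (κ⁻¹ · T₀ y)                ≈⟨ *-congˡ (det-·ʳ κ⁻¹ (T₀ x) (T₀ y)) ⟩
        κ⁻¹ *ᴸ (κ⁻¹ *ᴸ det (T₀ x) (T₀ y))             ≈⟨ *-congˡ (*-congˡ (trans (det-T₀ x y) (*-congʳ (sym κκ≈δ)))) ⟩
        κ⁻¹ *ᴸ (κ⁻¹ *ᴸ (κ *ᴸ κ *ᴸ σ (det x y)))       ≈⟨ solve 3 (λ i k d → i :* (i :* (k :* k :* d)) := (k :* i) :* ((k :* i) :* d))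
                                                           refl κ⁻¹ κ (σ (det x y)) ⟩
        (κ *ᴸ κ⁻¹) *ᴸ ((κ *ᴸ κ⁻¹) *ᴸ σ (det x y))     ≈⟨ *-cong κκ⁻¹≈1 (*-congʳ κκ⁻¹≈1) ⟩
        1# *ᴸ (1# *ᴸ σ (det x y))                     ≈⟨ trans (*-identityˡ _) (*-identityˡ _) ⟩
        σ (det x y)                                   ∎
    ; anisotropic = λ {x} eq →
        T₀-anisotropic x (trans (sym (κdetT≈detT₀ x x)) (trans (*-congˡ eq) (zeroʳ κ)))
    }

  module _ (l : Carrier) where
    open TwistedMultiplication.Multiplication {L = L} isField 1+1≈0 _≟_ twist κ l

    B-mul≈⊛ : ∀ x y → B-mul L s l t x y ≈ᵥ x ⊛ y
    B-mul≈⊛ x@(a , b) y@(c , d) =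
        trans (solve 13 (λ p₁ p₂ p₃ p₄ l a b c d a′ b′ c′ d′ →
            p₁ :* a :* c′ :+ l :* p₁ :* a′ :* c :+ p₂ :* b :* c′ :+ l :* p₂ :* a′ :* d
            :+ p₃ :* a :* d′ :+ l :* p₃ :* b′ :* c :+ p₄ :* b :* d′ :+ l :* p₄ :* b′ :* d
              := (a :* (p₁ :* c′ :+ p₃ :* d′) :+ b :* (p₂ :* c′ :+ p₄ :* d′))
                 :+ l :* (c :* (p₁ :* a′ :+ p₃ :* b′) :+ d :* (p₂ :* a′ :+ p₄ :* b′)))
            refl p₁ p₂ p₃ p₄ l a b c d (σ a) (σ b) (σ c) (σ d))
          (sym (+-cong (κdetT≈detT₀ x y) (*-congˡ (κdetT≈detT₀ y x))))
      , refl

isomorphism⇒inverse : ∀ {a b ℓ₁ ℓ₂} (G : AbelianGroup a ℓ₁) (H : AbelianGroup b ℓ₂) {f} →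
  GroupMorphisms.IsGroupIsomorphism (AbelianGroup.rawGroup G) (AbelianGroup.rawGroup H) f →
  Inverse (AbelianGroup.setoid G) (AbelianGroup.setoid H)
isomorphism⇒inverse G H {f} iso = Bijection⇒Inverse record
  { to        = f
  ; cong      = ⟦⟧-cong
  ; bijective = injective , surjective
  }
  where open GroupMorphisms.IsGroupIsomorphism iso

-- Transport along the isotopism

module Isotope {c ℓ a ℓ₁} {m s : ℕ} (1≤m : 1 ≤ m) (0<s : 0 < s) (s<2m : s < 2 * m) (s≢m : s ≢ m)
  {L : CommutativeRing c ℓ} (gf : IsGF (2 ^ m) L) {t : Quadruple L} (legitimate : Legitimate L s t)
  {l : CommutativeRing.Carrier L} (l≉0 : ¬ CommutativeRing._≈_ L l (CommutativeRing.0# L))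
  (l-nonpower : ¬ IsPowerOfUnit L (2 ^ s ∸ 1) l)
  {S : NonAssociativeRing a ℓ₁} (isSemifield : IsSemifield S) (isotopic : IsotopicToB L S s l t) where

  private
    module L = CommutativeRing L
    module S = NonAssociativeRing S
    module ≈-Reasoning = SetoidReasoning S.setoid

  open IsGF gf
  open Field isField using (*-cancelˡ)
  open Finite L.setoid cardinality
  open BinaryField {L = L} 1≤m gf
  open CharTwoSolver {L = L} 1+1≈0
  open CharTwoField {L = L} isField 1+1≈0
  open Plane {L = L} isField 1+1≈0
  open Twisted {L = L} isField 1+1≈0 _≟_
  open LegitimateTwist {L = L} 1≤m gf s legitimate
  open TwistedMultiplication {L = L} isField 1+1≈0 _≟_
  open Multiplication twist κ l
  open IsTwist twist

  private
    module ≈ᵥ-Reasoning = SetoidReasoning setoidᵥ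

  order : HasOrder σ (proj₁ (frobenius-order s))
  order = let _ , period , minimal = frobenius-order s in record { period = period ; minimal = minimal }

  open Powers twist order
  open Autotopy order

  σ-moves : ∃[ μ ] ¬ σ μ L.≈ μ
  σ-moves = frobenius-nontrivial 0<s s<2m s≢m

  open Nuclei κ≉0 l≉0 (proj₂ σ-moves)

  -- Cancelling k in σ(k) = l k would exhibit l as k to the power σ - 1.
  noEigenvector : ∀ {k} → σ k L.≈ l L.* k → k L.≈ L.0#
  noEigenvector {k} eq = decidable-stable (k ≟ L.0#) λ k≉0 →
    l-nonpower (k , k≉0 , *-cancelˡ k≉0 (L.trans (L.reflexive (≡.cong (k ^ᴸ_) σ-suc)) (L.trans eq (L.*-comm l k))))
    where
    open import Algebra.Properties.Semiring.Exp L.semiring using () renaming (_^_ to _^ᴸ_)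
    σ-suc : suc (2 ^ s ∸ 1) ≡ 2 ^ s
    σ-suc = ℕ.m+[n∸m]≡n (ℕ.m^n>0 2 s)

  -- The map is additive with trivial kernel by `noEigenvector`, and an injective map on a finite
  -- set is onto.
  σ+l-surjective : ∀ y → ∃[ k ] σ k L.+ l L.* k L.≈ y
  σ+l-surjective = injective⇒strictlySurjective λ {x} {y} eq →
    x+y≈0⇒x≈y (noEigenvector (x+y≈0⇒x≈y (begin
      σ (x L.+ y) L.+ l L.* (x L.+ y)                    ≈⟨ L.+-congʳ (σ-+ x y) ⟩
      (σ x L.+ σ y) L.+ l L.* (x L.+ y)                  ≈⟨ solve 5 (λ s t l x y → (s :+ t) :+ l :* (x :+ y)
                                                              := (s :+ l :* x) :+ (t :+ l :* y)) L.refl (σ x) (σ y) l x y ⟩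
      (σ x L.+ l L.* x) L.+ (σ y L.+ l L.* y)            ≈⟨ x≈y⇒x+y≈0 eq ⟩
      L.0#                                               ∎)))
    where open SetoidReasoning L.setoid

  open Central noEigenvector σ+l-surjective
  open SemifieldNuclei {S = S} isSemifield hiding (*-cancelˡ)

  private
    module I = Isotopic isotopic
    module α₁ = Inverse (isomorphism⇒inverse (B-group L) S.+-abelianGroup I.α₁-iso)
    module α₂ = Inverse (isomorphism⇒inverse (B-group L) S.+-abelianGroup I.α₂-iso)
    module β  = Inverse (isomorphism⇒inverse S.+-abelianGroup (B-group L) I.β-iso)
    module α₁-hom = GroupMorphisms.IsGroupIsomorphism I.α₁-iso
    module β-hom = GroupMorphisms.IsGroupIsomorphism I.β-iso

    -- Operators on the plane are turned into elements of `S` by evaluating them at this image of 1.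
    v : V
    v = α₁.from S.1#

  β-* : ∀ x y → β.to (x S.* y) ≈ᵥ α₁.from x ⊛ α₂.from y
  β-* x y = begin
    β.to (x S.* y)                                        ≈⟨ β.to-cong (S.*-cong (α₁.strictlyInverseˡ x) (α₂.strictlyInverseˡ y)) ⟨
    β.to (α₁.to (α₁.from x) S.* α₂.to (α₂.from y))        ≈⟨ I.isotopic _ _ ⟩
    B-mul L s l t (α₁.from x) (α₂.from y)                 ≈⟨ B-mul≈⊛ l _ _ ⟩
    α₁.from x ⊛ α₂.from y                                 ∎
    where open ≈ᵥ-Reasoning

  ⊛-β : ∀ x y → x ⊛ y ≈ᵥ β.to (α₁.to x S.* α₂.to y)
  ⊛-β x y = begin
    x ⊛ y                                                 ≈⟨ ⊛-cong (α₁.strictlyInverseʳ x) (α₂.strictlyInverseʳ y) ⟨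
    α₁.from (α₁.to x) ⊛ α₂.from (α₂.to y)                 ≈⟨ β-* (α₁.to x) (α₂.to y) ⟨
    β.to (α₁.to x S.* α₂.to y)                            ∎
    where open ≈ᵥ-Reasoning

  conjugate-adjoint : ∀ {A B : V → V} → (∀ {x y} → x ≈ᵥ y → A x ≈ᵥ A y) → (∀ {x y} → x ≈ᵥ y → B x ≈ᵥ B y) →
    (∀ x y → A x ⊛ y ≈ᵥ x ⊛ B y) → Adjoint (α₁.to ∘ A ∘ α₁.from) (α₂.to ∘ B ∘ α₂.from)
  conjugate-adjoint {A} {B} A-cong B-cong adj x y = β-hom.injective (begin
    β.to (α₁.to (A (α₁.from x)) S.* y)                    ≈⟨ β-* _ y ⟩
    α₁.from (α₁.to (A (α₁.from x))) ⊛ α₂.from y           ≈⟨ ⊛-cong (α₁.strictlyInverseʳ _) reflᵥ ⟩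
    A (α₁.from x) ⊛ α₂.from y                             ≈⟨ adj (α₁.from x) (α₂.from y) ⟩
    α₁.from x ⊛ B (α₂.from y)                             ≈⟨ ⊛-cong reflᵥ (α₂.strictlyInverseʳ _) ⟨
    α₁.from x ⊛ α₂.from (α₂.to (B (α₂.from y)))           ≈⟨ β-* x _ ⟨
    β.to (x S.* α₂.to (B (α₂.from y)))                    ∎)
    where open ≈ᵥ-Reasoning

  scalar-homothety : ∀ {k} → σ k L.≈ k →
    Homothety (α₁.to ∘ (k ·_) ∘ α₁.from) (α₂.to ∘ (k ·_) ∘ α₂.from) (β.from ∘ (k ·_) ∘ β.to)
  scalar-homothety {k} σk≈k = record
    { C-cong = λ eq → β.from-cong (·-cong L.refl (β.to-cong eq))
    ; left   = λ x y → β-hom.injective (begin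
        β.to (α₁.to (k · α₁.from x) S.* y)                ≈⟨ β-* _ y ⟩
        α₁.from (α₁.to (k · α₁.from x)) ⊛ α₂.from y       ≈⟨ ⊛-cong (α₁.strictlyInverseʳ _) reflᵥ ⟩
        k · α₁.from x ⊛ α₂.from y                         ≈⟨ ·-⊛ σk≈k _ _ ⟩
        k · (α₁.from x ⊛ α₂.from y)                       ≈⟨ scaled x y ⟩
        β.to (β.from (k · β.to (x S.* y)))                ∎)
    ; right  = λ x y → β-hom.injective (begin
        β.to (x S.* α₂.to (k · α₂.from y))                ≈⟨ β-* x _ ⟩
        α₁.from x ⊛ α₂.from (α₂.to (k · α₂.from y))       ≈⟨ ⊛-cong reflᵥ (α₂.strictlyInverseʳ _) ⟩
        α₁.from x ⊛ k · α₂.from y                         ≈⟨ ⊛-· σk≈k _ _ ⟩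
        k · (α₁.from x ⊛ α₂.from y)                       ≈⟨ scaled x y ⟩
        β.to (β.from (k · β.to (x S.* y)))                ∎)
    }
    where
    open ≈ᵥ-Reasoning
    scaled : ∀ x y → k · (α₁.from x ⊛ α₂.from y) ≈ᵥ β.to (β.from (k · β.to (x S.* y)))
    scaled x y = transᵥ (·-cong L.refl (symᵥ (β-* x y))) (symᵥ (β.strictlyInverseˡ _))

  scalar : L.Carrier → S.Carrier
  scalar k = α₁.to (k · v)

  scalar∈center : ∀ {k} → σ k L.≈ k → scalar k ∈ Center S
  scalar∈center σk≈k = homothety⇒center (scalar-homothety σk≈k)

  scalar-* : ∀ {k} → σ k L.≈ k → ∀ x → scalar k S.* x S.≈ α₁.to (k · α₁.from x)
  scalar-* σk≈k x = S.sym (homothety-multiplication (scalar-homothety σk≈k) x)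

  -- Right multiplication by u, seen on the plane. In (x u) y it acts on the left factor, hence the
  -- conjugation by `α₁`.
  transfer : S.Carrier → V → V
  transfer u x = α₁.from (α₁.to x S.* u)

  transfer-cong : ∀ u {x y} → x ≈ᵥ y → transfer u x ≈ᵥ transfer u y
  transfer-cong u x≈y = α₁.from-cong (S.*-congʳ (α₁.to-cong x≈y))

  transfer-⊛ : ∀ u x y → transfer u x ⊛ y ≈ᵥ β.to ((α₁.to x S.* u) S.* α₂.to y)
  transfer-⊛ u x y = transᵥ (⊛-β _ y) (β.to-cong (S.*-congʳ (α₁.strictlyInverseˡ _)))

  module _ {u} (u∈ : u ∈ MiddleNucleus S) where
    private
      transpose : V → V
      transpose y = α₂.from (u S.* α₂.to y)

      transfer-adjoint : ∀ x y → transfer u x ⊛ y ≈ᵥ x ⊛ transpose y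
      transfer-adjoint x y = begin
        transfer u x ⊛ y                                  ≈⟨ transfer-⊛ u x y ⟩
        β.to ((α₁.to x S.* u) S.* α₂.to y)                ≈⟨ β.to-cong (u∈ _ _) ⟨
        β.to (α₁.to x S.* (u S.* α₂.to y))                ≈⟨ β.to-cong (S.*-congˡ (α₂.strictlyInverseˡ _)) ⟨
        β.to (α₁.to x S.* α₂.to (transpose y))            ≈⟨ ⊛-β x (transpose y) ⟨
        x ⊛ transpose y                                   ∎
        where open ≈ᵥ-Reasoning

    transfer-linear : IsLinear (transfer u)
    transfer-linear = middle-linear {transfer u} {transpose} (transfer-cong u) transfer-adjoint

    transfer-commutant : ∃₂ λ α β → σ α L.≈ α × σ β L.≈ β × (∀ x → transfer u x ≈ᵥ α · x +ᵥ β · N x)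
    transfer-commutant = T-commutant transfer-linear
      (middle-commutes {transfer u} {transpose} (transfer-cong u) transfer-adjoint)

  -- For central u, (x u) y = (u x) y = u (x y), so `C` is left multiplication by u conjugated by
  -- `β`.
  center-transfer : ∀ {u} → u ∈ Center S → ∀ x → det x (transfer u x) L.≈ L.0#
  center-transfer {u} u∈ = central-scalar {C = C} (transfer-linear (center⊆middle u∈))
    (λ eq → β.to-cong (S.*-congˡ (β.from-cong eq))) λ x y → begin
      transfer u x ⊛ y                                  ≈⟨ transfer-⊛ u x y ⟩
      β.to ((α₁.to x S.* u) S.* α₂.to y)                ≈⟨ β.to-cong (S.*-congʳ (proj₂ (proj₂ (proj₂ u∈)) _)) ⟨
      β.to ((u S.* α₁.to x) S.* α₂.to y)                ≈⟨ β.to-cong (proj₁ u∈ _ _) ⟨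
      β.to (u S.* (α₁.to x S.* α₂.to y))                ≈⟨ β.to-cong (S.*-congˡ (β.strictlyInverseʳ _)) ⟨
      C (β.to (α₁.to x S.* α₂.to y))                    ≈⟨ β.to-cong (S.*-congˡ (β.from-cong (⊛-β x y))) ⟨
      C (x ⊛ y)                                         ∎
    where
    open ≈ᵥ-Reasoning
    C : V → V
    C z = β.to (u S.* β.from z)

  N-conjugate : Adjoint (α₁.to ∘ N ∘ α₁.from) (α₂.to ∘ N⁻¹ ∘ α₂.from)
  N-conjugate = conjugate-adjoint (IsSemilinear.F-cong N-linear) N⁻¹-cong N-middle

  generator : S.Carrier
  generator = α₁.to (N v)

  generator∈middle : generator ∈ MiddleNucleus S
  generator∈middle = adjoint⇒middle N-conjugate

  -- Right multiplication by `generator` transfers to N, and `N-cyclic` provides an x with det(x, N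
  -- x) ≠ 0, which `center-transfer` forbids.
  generator∉center : generator ∉ Center S
  generator∉center g∈ =
    let x , det≉0 = N-cyclic
    in det≉0 (L.trans (det-congˡ (symᵥ (transfer-generator x))) (center-transfer g∈ x))
    where
    transfer-generator : ∀ x → transfer generator x ≈ᵥ N x
    transfer-generator x = begin
      α₁.from (α₁.to x S.* generator)                   ≈⟨ α₁.from-cong (adjoint-multiplication N-conjugate (α₁.to x)) ⟨
      α₁.from (α₁.to (N (α₁.from (α₁.to x))))           ≈⟨ α₁.strictlyInverseʳ _ ⟩
      N (α₁.from (α₁.to x))                             ≈⟨ IsSemilinear.F-cong N-linear (α₁.strictlyInverseʳ x) ⟩
      N x                                               ∎
      where open ≈ᵥ-Reasoning

  transfer-from : ∀ u x → α₁.from (x S.* u) ≈ᵥ transfer u (α₁.from x)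
  transfer-from u x = α₁.from-cong (S.*-congʳ (S.sym (α₁.strictlyInverseˡ x)))

  -- Evaluating the transferred operator α + β N at `v` recovers u. The coefficients are fixed by σ,
  -- so they become central elements that multiply in `S` as they do on the plane.
  middle-spanned : ∀ {u} → u ∈ MiddleNucleus S →
    ∃₂ λ r q → r ∈ Center S × q ∈ Center S × u S.≈ r S.* S.1# S.+ q S.* generator
  middle-spanned {u} u∈ =
    let α , β , σα≈α , σβ≈β , transfer≈ = transfer-commutant u∈ in
    scalar α , scalar β , scalar∈center σα≈α , scalar∈center σβ≈β , (begin
      u                                                 ≈⟨ α₁.strictlyInverseˡ u ⟨
      α₁.to (α₁.from u)                                 ≈⟨ α₁.to-cong (α₁.from-cong (S.*-identityˡ u)) ⟨
      α₁.to (α₁.from (S.1# S.* u))                      ≈⟨ α₁.to-cong (transfer-from u S.1#) ⟩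
      α₁.to (transfer u v)                              ≈⟨ α₁.to-cong (transfer≈ v) ⟩
      α₁.to (α · v +ᵥ β · N v)                          ≈⟨ α₁-hom.∙-homo _ _ ⟩
      scalar α S.+ α₁.to (β · N v)                      ≈⟨ S.+-cong (S.sym (S.*-identityʳ _))
                                                             (α₁.to-cong (·-cong L.refl (symᵥ (α₁.strictlyInverseʳ (N v))))) ⟩
      scalar α S.* S.1# S.+ α₁.to (β · α₁.from generator)  ≈⟨ S.+-cong S.refl (scalar-* σβ≈β generator) ⟨
      scalar α S.* S.1# S.+ scalar β S.* generator      ∎)
    where open ≈-Reasoning

  -- The product u w corresponds to `transfer w` after `transfer u`, and both maps are of the form α
  -- + β N, so they commute.
  middle-comm : ∀ {u w} → u ∈ MiddleNucleus S → w ∈ MiddleNucleus S → u S.* w S.≈ w S.* u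
  middle-comm {u} {w} u∈ w∈ = α₁-from-injective (begin
    α₁.from (u S.* w)                                   ≈⟨ product u w ⟩
    transfer w (transfer u v)                           ≈⟨ transfer-comm ⟩
    transfer u (transfer w v)                           ≈⟨ product w u ⟨
    α₁.from (w S.* u)                                   ∎)
    where
    open ≈ᵥ-Reasoning
    α₁-from-injective : ∀ {x y} → α₁.from x ≈ᵥ α₁.from y → x S.≈ y
    α₁-from-injective {x} {y} eq =
      S.trans (S.sym (α₁.strictlyInverseˡ x)) (S.trans (α₁.to-cong eq) (α₁.strictlyInverseˡ y))
    product : ∀ u w → α₁.from (u S.* w) ≈ᵥ transfer w (transfer u v)
    product u w = transᵥ (transfer-from w u) (transfer-cong w
      (transᵥ (α₁.from-cong (S.sym (S.*-identityˡ u))) (transfer-from u S.1#)))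
    transfer-comm : transfer w (transfer u v) ≈ᵥ transfer u (transfer w v)
    transfer-comm =
      let α , β , _ , _ , u≈ = transfer-commutant u∈
          γ , δ , _ , _ , w≈ = transfer-commutant w∈
          w-lin = transfer-linear w∈
      in begin
      transfer w (transfer u v)                                 ≈⟨ transfer-cong w (u≈ v) ⟩
      transfer w (α · v +ᵥ β · N v)                             ≈⟨ F-combination w-lin α β v (N v) ⟩
      α · transfer w v +ᵥ β · transfer w (N v)                  ≈⟨ +ᵥ-cong reflᵥ (·-cong L.refl (wN≈Nw γ δ w≈)) ⟩
      α · transfer w v +ᵥ β · N (transfer w v)                  ≈⟨ u≈ (transfer w v) ⟨
      transfer u (transfer w v)                                 ∎
      where
      wN≈Nw : ∀ γ δ → (∀ x → transfer w x ≈ᵥ γ · x +ᵥ δ · N x) → transfer w (N v) ≈ᵥ N (transfer w v)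
      wN≈Nw γ δ w≈ = begin
        transfer w (N v)               ≈⟨ w≈ (N v) ⟩
        γ · N v +ᵥ δ · N (N v)         ≈⟨ F-combination N-linear γ δ v (N v) ⟨
        N (γ · v +ᵥ δ · N v)           ≈⟨ IsSemilinear.F-cong N-linear (w≈ v) ⟨
        N (transfer w v)               ∎

  -- With 1 = 0 the ring `S` would be trivial, but it is in bijection with the plane, where `e₁`
  -- differs from 0.
  1≉0ˢ : ¬ S.1# S.≈ S.0#
  1≉0ˢ 1≈0 = IsField.1≉0 isField (proj₁ (begin
    e₁                     ≈⟨ α₁.strictlyInverseʳ e₁ ⟨
    α₁.from (α₁.to e₁)     ≈⟨ α₁.from-cong (trivial (α₁.to e₁)) ⟩
    α₁.from S.0#           ≈⟨ α₁.from-cong (trivial (α₁.to 0ᵥ)) ⟨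
    α₁.from (α₁.to 0ᵥ)     ≈⟨ α₁.strictlyInverseʳ 0ᵥ ⟩
    0ᵥ                     ∎))
    where
    open ≈ᵥ-Reasoning
    trivial : ∀ x → x S.≈ S.0#
    trivial x = S.trans (S.sym (S.*-identityˡ x)) (S.trans (S.*-congʳ 1≈0) (S.zeroˡ x))

  isQuadraticExtension : IsQuadraticExtension S (Center S) (MiddleNucleus S)
  isQuadraticExtension = record
    { base-isSubfield = center-isSubfield 1≉0ˢ
    ; ext-isSubfield  = ext-isSubfield
    ; base⊆ext        = center⊆middle
    ; degree-two      = S.1# , generator , record
      { e₁∈E        = IsSubfield.1-closed ext-isSubfield
      ; e₂∈E        = generator∈middle
      ; spanning    = middle-spanned
      ; independent = center-independent 1≉0ˢ generator∉center
      }
    }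
    where ext-isSubfield = middle-isSubfield 1≉0ˢ middle-comm

theorem9 : ∀ {c ℓ a ℓ₁} (m s : ℕ) → 1 ≤ m → 0 < s → s < 2 * m → s ≢ m →
    (L : CommutativeRing c ℓ) → IsGF (2 ^ m) L →
    (t : Quadruple L) → Legitimate L s t →
    (l : CommutativeRing.Carrier L) →
    ¬ (CommutativeRing._≈_ L l (CommutativeRing.0# L)) →
    ¬ (IsPowerOfUnit L (2 ^ s ∸ 1) l) →
    (S : NonAssociativeRing a ℓ₁) → IsSemifield S →
    IsotopicToB L S s l t →
    IsQuadraticExtension S (Center S) (MiddleNucleus S)
theorem9 m s 1≤m 0<s s<2m s≢m L gf t legitimate l l≉0 l-nonpower S isSemifield isotopic =
  Isotope.isQuadraticExtension 1≤m 0<s s<2m s≢m gf legitimate l≉0 l-nonpower isSemifield isotopic
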